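{- Let $t_n$ denote the Fine numbers and $C_n$ the Catalan numbers, let $D_{\pm}(a_1,\ldots,a_n)$ denote the $n\times n$ Hessenberg--Toeplitz determinant with superdiagonal entries $\pm1$, and let $A137398[n]$ ($n\ge1$) and $A030238[n]$ ($n\ge0$) be the integer sequences defined in the context. Let $(u_n)_{n\ge1}$ be the sequence defined by $u_1=u_2=1$ and $$u_n=u_{n-1}+\sum_{i=1}^{n-2}(-1)^{i+1}C_iu_{n-i-1},\qquad n\ge3.$$ Then the following formulas hold for all $n\ge1$, unless stated otherwise: \begin{align*} D_+(t_1,t_2,\ldots,t_n)&=u_n,\\ D_-(t_1,t_2,\ldots,t_n)&=C_{n-1},\\ D_+(t_2,t_3,\ldots,t_{n+1})&=(-1)^{n-1}C_{n-1}\quad(n\ge2),\\ D_-(t_2,t_3,\ldots,t_{n+1})&=A137398[n],\\ D_+(t_3,t_4,\ldots,t_{n+2})&=(-1)^{n-1}A030238[n-1],\\ D_+(t_4,t_5,\ldots,t_{n+3})&=(-1)^{n-1}C_{n-1}\quad(n\ge3). \end{align*}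
   Context: Fine numbers: $t_0=0$ and $t_n=3\sum_{k=1}^{\lfloor (n+1)/2\rfloor}\binom{2n-2k}{n-1}-\binom{2n}{n}$ for $n\ge1$, so $(t_n)_{n\ge0}=0,1,0,1,2,6,18,57,186,\ldots$. Catalan numbers: $C_n=\frac1{n+1}\binom{2n}n$ for $n\ge0$. Determinants: for $a_0\in\{1,-1\}$ and numbers $a_1,\ldots,a_n$, let $A_n(a_0;a_1,\ldots,a_n)$ be the $n\times n$ matrix whose $(i,j)$ entry is $a_{i-j+1}$ if $j\le i$, $a_0$ if $j=i+1$, and $0$ if $j>i+1$. Put $D_{+}(a_1,\ldots,a_n)=\det A_n(1;a_1,\ldots,a_n)$ and $D_{ - }(a_1,\ldots,a_n)=\det A_n(-1;a_1,\ldots,a_n)$. OEIS sequences: $A137398[n]=b_n$ for $n\ge1$, where $b_1=0$, $b_2=1$, $b_3=2$ and $b_n=2b_{n-1}+2b_{n-2}+\sum_{k=1}^{n-3}C_kb_{n-k-1}$ for $n\ge4$. For $n\ge0$, $A030238[n]=\sum_{j=1}^{\lfloor (n+2)/2\rfloor}a(n+2-j,j)$, where $a(m,j)$ is the number of Dyck paths from $(0,0)$ to $(2m,0)$ (steps $u=(1,1)$ and $d=(1,-1)$, never going below the $x$-axis) having exactly $j$ returns, i.e., exactly $j$ steps $d$ that end on the $x$-axis (including the final step). -}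

module Defs where

open import Data.Bool.Base using (if_then_else_)
open import Data.Fin.Base as Fin using (Fin; toℕ; fromℕ<; punchIn)
open import Data.Fin.Properties using (toℕ<n)
open import Data.Integer.Base as ℤ using (ℤ; +_; 0ℤ; 1ℤ; -1ℤ)
import Data.Integer.Properties as ℤ
open import Data.List.Base using (List; []; _∷_; _++_; map; length; filter)
open import Data.List.Relation.Unary.All using (All; all?)
open import Data.Nat.Base as ℕ using (ℕ; zero; suc; _+_; _*_; _∸_; _<_; s≤s; ⌊_/2⌋)
open import Data.Nat.Combinatorics using (_C_)
open import Data.Nat.DivMod using (_/_)
open import Data.Nat.Induction using (<-Rec; <-rec; <-wellFounded)
import Data.Nat.Properties as ℕ
open import Data.Product.Base using (_×_)
open import Data.Vec.Functional using (Vector)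
open import Induction.WellFounded using (module FixPoint)
open import Relation.Binary.PropositionalEquality.Core using (_≡_; refl; cong; cong₂)
open import Relation.Nullary.Decidable.Core using (Dec; does; yes; no; _×-dec_)

open import Algebra.Properties.Semiring.Sum ℕ.+-*-semiring
  using () renaming (sum to sumℕ; sum-cong-≗ to sumℕ-cong)
open import Algebra.Properties.Semiring.Sum ℤ.+-*-semiring
  using () renaming (sum to sumℤ; sum-cong-≗ to sumℤ-cong)

∑ℕ : ℕ → (ℕ → ℕ) → ℕ
∑ℕ n f = sumℕ {n} (λ k → f (suc (toℕ k)))

∑ℤ : ℕ → (ℕ → ℤ) → ℤ
∑ℤ n f = sumℤ {n} (λ k → f (suc (toℕ k)))

infixl 5 ∑ℕ ∑ℤ

syntax ∑ℕ n (λ k → e) = ∑ℕ[1≤ k ≤ n ] e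
syntax ∑ℤ n (λ k → e) = ∑ℤ[1≤ k ≤ n ] e

-- The division is exact.
catalan : ℕ → ℕ
catalan n = ((2 * n) C n) / suc n

fine : ℕ → ℤ
fine zero      = 0ℤ
fine n@(suc _) =
  + (3 * (∑ℕ[1≤ k ≤ ⌊ n + 1 /2⌋ ] ((2 * n ∸ 2 * k) C (n ∸ 1))))
    ℤ.- + ((2 * n) C n)

fineFrom : (s n : ℕ) → Vector ℤ n
fineFrom s n k = fine (s + toℕ k)

Matrix : ℕ → Set
Matrix n = Fin n → Fin n → ℤ

-- Cofactor expansion along the first row.
det : ∀ {n} → Matrix n → ℤ
det {zero}  M = 1ℤ
det {suc n} M = sumℤ λ j →
  (-1ℤ ℤ.^ toℕ j) ℤ.* M Fin.zero j ℤ.* det (λ i k → M (Fin.suc i) (punchIn j k))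

infixl 6 _⊖_

-- Truncated subtraction; only used below when j ≤ i.
_⊖_ : ∀ {n} → Fin n → Fin n → Fin n
i ⊖ j = fromℕ< (ℕ.≤-<-trans (ℕ.m∸n≤m (toℕ i) (toℕ j)) (toℕ<n i))

-- Rows, columns and the vector a are indexed from 0, so a_m is a (m - 1)
-- and the entry a_{i-j+1} is a (i ⊖ j).
hessenbergToeplitz : ∀ {n} → ℤ → Vector ℤ n → Matrix n
hessenbergToeplitz a₀ a i j with toℕ j ℕ.≤? toℕ i | toℕ j ℕ.≟ suc (toℕ i)
... | yes _ | _     = a (i ⊖ j)
... | no  _ | yes _ = a₀
... | no  _ | no  _ = 0ℤ

D₊ D₋ : ∀ {n} → Vector ℤ n → ℤ
D₊ a = det (hessenbergToeplitz 1ℤ a)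
D₋ a = det (hessenbergToeplitz -1ℤ a)

private
  n∸i∸1<n : ∀ n i .{{_ : ℕ.NonZero n}} → n ∸ i ∸ 1 < n
  n∸i∸1<n n@(suc _) i = s≤s (ℕ.∸-monoˡ-≤ 1 (ℕ.m∸n≤m n i))

-- The sequence starts at index 1; its value at 0 is a dummy, never used
-- in the recurrence.
u-step : ∀ n → <-Rec (λ _ → ℤ) n → ℤ
u-step 0 _ = 0ℤ
u-step 1 _ = 1ℤ
u-step 2 _ = 1ℤ
u-step n@(suc (suc (suc _))) u′ =
  u′ {n ∸ 1} ℕ.≤-refl ℤ.+
  (∑ℤ[1≤ i ≤ n ∸ 2 ] ((-1ℤ ℤ.^ (i + 1)) ℤ.* + catalan i ℤ.* u′ {n ∸ i ∸ 1} (n∸i∸1<n n i)))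

u : ℕ → ℤ
u = <-rec (λ _ → ℤ) u-step

private
  u-step-ext : ∀ n {f g : <-Rec (λ _ → ℤ) n} →
               (∀ {m} (m<n : m < n) → f m<n ≡ g m<n) → u-step n f ≡ u-step n g
  u-step-ext 0 _ = refl
  u-step-ext 1 _ = refl
  u-step-ext 2 _ = refl
  u-step-ext (suc (suc (suc m))) f≗g =
    cong₂ ℤ._+_ (f≗g _) (sumℤ-cong {suc m} λ i →
      cong ((-1ℤ ℤ.^ (suc (toℕ i) + 1)) ℤ.* + catalan (suc (toℕ i)) ℤ.*_) (f≗g (n∸i∸1<n (3 + m) (suc (toℕ i)))))

u-rec : ∀ n → 3 ℕ.≤ n →
        u n ≡ u (n ∸ 1) ℤ.+
          (∑ℤ[1≤ i ≤ n ∸ 2 ] ((-1ℤ ℤ.^ (i + 1)) ℤ.* + catalan i ℤ.* u (n ∸ i ∸ 1)))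
u-rec (suc (suc (suc m))) (s≤s (s≤s (s≤s _))) =
  FixPoint.unfold-wfRec <-wellFounded (λ _ → ℤ) u-step u-step-ext {3 + m}

-- Again the value at 0 is a dummy.
A137398-step : ∀ n → <-Rec (λ _ → ℕ) n → ℕ
A137398-step 0 _ = 0
A137398-step 1 _ = 0
A137398-step 2 _ = 1
A137398-step 3 _ = 2
A137398-step n@(suc (suc (suc (suc _)))) b =
  2 * b {n ∸ 1} ℕ.≤-refl + 2 * b {n ∸ 2} (ℕ.n≤1+n _) +
  (∑ℕ[1≤ k ≤ n ∸ 3 ] (catalan k * b {n ∸ k ∸ 1} (n∸i∸1<n n k)))

A137398 : ℕ → ℕ
A137398 = <-rec (λ _ → ℕ) A137398-step

private
  A137398-step-ext : ∀ n {f g : <-Rec (λ _ → ℕ) n} →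
                     (∀ {m} (m<n : m < n) → f m<n ≡ g m<n) →
                     A137398-step n f ≡ A137398-step n g
  A137398-step-ext 0 _ = refl
  A137398-step-ext 1 _ = refl
  A137398-step-ext 2 _ = refl
  A137398-step-ext 3 _ = refl
  A137398-step-ext (suc (suc (suc (suc m)))) f≗g =
    cong₂ _+_ (cong₂ _+_ (cong (2 *_) (f≗g _)) (cong (2 *_) (f≗g _)))
      (sumℕ-cong {suc m} λ k → cong (catalan (suc (toℕ k)) *_) (f≗g (n∸i∸1<n (4 + m) (suc (toℕ k)))))

A137398-rec : ∀ n → 4 ℕ.≤ n →
              A137398 n ≡ 2 * A137398 (n ∸ 1) + 2 * A137398 (n ∸ 2) +
                (∑ℕ[1≤ k ≤ n ∸ 3 ] (catalan k * A137398 (n ∸ k ∸ 1)))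
A137398-rec (suc (suc (suc (suc m)))) (s≤s (s≤s (s≤s (s≤s _)))) =
  FixPoint.unfold-wfRec <-wellFounded (λ _ → ℕ) A137398-step A137398-step-ext {4 + m}

data Step : Set where
  up down : Step

move : Step → ℤ → ℤ
move up   = ℤ.suc
move down = ℤ.pred

-- The starting height h itself is not included.
heights : ℤ → List Step → List ℤ
heights h []       = []
heights h (s ∷ ss) = move s h ∷ heights (move s h) ss

finalHeight : ℤ → List Step → ℤ
finalHeight h []       = h
finalHeight h (s ∷ ss) = finalHeight (move s h) ss

IsDyck : List Step → Set
IsDyck p = All (0ℤ ℤ.≤_) (heights 0ℤ p) × finalHeight 0ℤ p ≡ 0ℤ

isDyck? : ∀ p → Dec (IsDyck p)
isDyck? p = all? (0ℤ ℤ.≤?_) (heights 0ℤ p) ×-dec (finalHeight 0ℤ p ℤ.≟ 0ℤ)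

-- The number of down steps ending on the x-axis, for a path starting at
-- height h.
returnsFrom : ℤ → List Step → ℕ
returnsFrom h []          = 0
returnsFrom h (up   ∷ ss) = returnsFrom (ℤ.suc h) ss
returnsFrom h (down ∷ ss) =
  (if does (ℤ.pred h ℤ.≟ 0ℤ) then 1 else 0) + returnsFrom (ℤ.pred h) ss

returns : List Step → ℕ
returns = returnsFrom 0ℤ

-- All 2ⁿ step sequences of length n, each listed once.
stepSequences : ℕ → List (List Step)
stepSequences zero    = [] ∷ []
stepSequences (suc n) = map (up ∷_) (stepSequences n) ++ map (down ∷_) (stepSequences n)

dyckWithReturns : (m j : ℕ) → ℕ
dyckWithReturns m j =
  length (filter (λ p → isDyck? p ×-dec (returns p ℕ.≟ j)) (stepSequences (2 * m)))

A030238 : ℕ → ℕ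
A030238 n = ∑ℕ[1≤ j ≤ ⌊ n + 2 /2⌋ ] dyckWithReturns (n + 2 ∸ j) j

{-# OPTIONS --safe #-}
-- Everything happens in the ring of formal power series over ℤ. With c = 1 + x c² the Catalan
-- series, the series S k of the binomials (2n+k choose n) equals c^k S 0, where S 0 = 1 + 2 x c S 0.
-- The sum defining the Fine numbers is therefore a geometric series in (x c)², which gives
-- F = 1 + x² c² F for F = ∑ t_{n+1} xⁿ, so that all shifts of the Fine numbers are rational in x and c.
-- Expanding a Hessenberg–Toeplitz determinant along its first row shows that the signed
-- determinants E = ∑ (-a₀)ⁿ Dₙ xⁿ satisfy E = 1 - a₀ x a E, where a = ∑ a_{n+1} xⁿ. In each of
-- the six cases a E and the claimed sequence solve the same fixpoint equation f = p + x h f, which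
-- has only one solution.
module Submission where

open import Defs
open import Algebra.Bundles using (CommutativeRing)
import Algebra.Solver.Ring
open import Algebra.Solver.Ring.AlmostCommutativeRing using (fromCommutativeRing; _-Raw-AlmostCommutative⟶_)
open import Algebra.Structures using (IsCommutativeRing)
open import Data.Fin.Base as Fin using (Fin; toℕ; punchIn)
open import Data.Fin.Properties using (toℕ-fromℕ<; toℕ<n)
open import Data.Integer.Base as ℤ using (ℤ; +_; 0ℤ; 1ℤ; -1ℤ; -_; _+_; _*_; _^_; +-*-rawRing)
import Data.Integer.Properties as ℤ
import Data.Integer.Solver as ℤ
open import Data.List.Base using (List; []; _∷_; _++_; map; length; filter)
open import Data.List.Properties using (filter-++; filter-≐; filter-none; length-++)
open import Data.List.Relation.Unary.All as All using (All; _∷_; all?)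
import Data.Maybe.Base as Maybe
open import Data.Nat.Base as ℕ using (ℕ; zero; suc; _∸_; _≤_; _<_; z≤n; s≤s; ⌊_/2⌋)
open import Data.Nat.Combinatorics using (_C_; nCk+nC[k+1]≡[n+1]C[k+1]; nCk≡nC[n∸k]; nC1≡n)
open import Data.Nat.DivMod using (_/_; m*n/n≡m)
open import Data.Nat.Induction using (<-rec)
import Data.Nat.Properties as ℕ
import Data.Nat.Solver as ℕ
open import Data.Product.Base using (_×_; _,_; Σ-syntax)
open import Data.Unit.Base using (⊤; tt)
open import Function.Base using (_∘_)
open import Level using (0ℓ)
open import Relation.Binary.PropositionalEquality.Core using (_≡_; refl; sym; trans; cong; cong₂; subst)
open import Relation.Binary.PropositionalEquality.Properties using (module ≡-Reasoning)
open import Relation.Nullary.Decidable.Core using (Dec; yes; no; _×-dec_; dec⇒maybe)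
open import Relation.Nullary.Negation.Core using (contradiction; ¬_)
open import Relation.Unary using (Pred; Decidable; _≐_)

open import Algebra.Properties.Semiring.Sum ℕ.+-*-semiring
  using () renaming (sum to sumℕ)
open import Algebra.Properties.Semiring.Sum ℤ.+-*-semiring
  using (sum-replicate-zero) renaming (sum to sumℤ; sum-cong-≗ to sumℤ-cong)

-- The determinants come out simply because their series depend only on reciprocals. Since E = 1/(1
-- + a₀ x a), the product a E equals 1/(1/a + a₀ x), and the reciprocals of F and of its double
-- shift H are linear in c: 1/F = 1 + x - x c and 1/H = 1 - x - x² - x c. The single shifts G and J
-- are covered by the same two reciprocals, through 1 + x G = F, G = x H and 1 + x J = H. The code
-- never divides. Clearing denominators in these formulas yields the multipliers `q`, `q′`, ... that
-- appear in the solver identities.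

Series : Set
Series = ℕ → ℤ

infixl 6 _⊕_
infixl 7 _⊗_
infix  8 ⊝_
infix  4 _≈_

-- A record rather than a function type, so that both series can be inferred.
record _≈_ (f g : Series) : Set where
  constructor pointwise
  field at : ∀ n → f n ≡ g n
open _≈_

convolution : Series → Series → Series
convolution f g zero    = f 0 * g 0
convolution f g (suc n) = f 0 * g (suc n) + convolution (f ∘ suc) g n

-- Opaque, so that the ring solver sees atoms.
opaque
  _⊕_ : Series → Series → Series
  (f ⊕ g) n = f n + g n

  ⊝_ : Series → Series
  (⊝ f) n = - f n

  _⊗_ : Series → Series → Series
  _⊗_ = convolution

  const : ℤ → Series
  const a zero    = a
  const a (suc n) = 0ℤ

  X : Series
  X 1 = 1ℤ
  X _ = 0ℤ

-- Ring laws of the Cauchy product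

module _ where
  open ℤ.+-*-Solver
  open ≡-Reasoning

  conv-cong : ∀ {f f′ g g′} n → (∀ {k} → k ≤ n → f k ≡ f′ k) → (∀ {k} → k ≤ n → g k ≡ g′ k) →
              convolution f g n ≡ convolution f′ g′ n
  conv-cong zero    f≡ g≡ = cong₂ _*_ (f≡ ℕ.z≤n) (g≡ ℕ.z≤n)
  conv-cong (suc n) f≡ g≡ =
    cong₂ _+_ (cong₂ _*_ (f≡ ℕ.z≤n) (g≡ ℕ.≤-refl)) (conv-cong n (f≡ ∘ s≤s) (g≡ ∘ ℕ.m≤n⇒m≤1+n))

  conv-sucʳ : ∀ f g n → convolution f g (suc n) ≡ f (suc n) * g 0 + convolution f (g ∘ suc) n
  conv-sucʳ f g zero    = ℤ.+-comm (f 0 * g 1) (f 1 * g 0)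
  conv-sucʳ f g (suc n) = begin
    f 0 * g (2 ℕ.+ n) + convolution (f ∘ suc) g (suc n)
      ≡⟨ cong (λ z → f 0 * g (2 ℕ.+ n) + z) (conv-sucʳ (f ∘ suc) g n) ⟩
    f 0 * g (2 ℕ.+ n) + (f (2 ℕ.+ n) * g 0 + convolution (f ∘ suc) (g ∘ suc) n)
      ≡⟨ solve 3 (λ a b c → a :+ (b :+ c) := b :+ (a :+ c)) refl
           (f 0 * g (2 ℕ.+ n)) (f (2 ℕ.+ n) * g 0) (convolution (f ∘ suc) (g ∘ suc) n) ⟩
    f (2 ℕ.+ n) * g 0 + convolution f (g ∘ suc) (suc n) ∎

  conv-comm : ∀ f g n → convolution f g n ≡ convolution g f n
  conv-comm f g zero    = ℤ.*-comm (f 0) (g 0)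
  conv-comm f g (suc n) = begin
    f 0 * g (suc n) + convolution (f ∘ suc) g n ≡⟨ cong₂ _+_ (ℤ.*-comm (f 0) (g (suc n))) (conv-comm (f ∘ suc) g n) ⟩
    g (suc n) * f 0 + convolution g (f ∘ suc) n ≡⟨ conv-sucʳ g f n ⟨
    convolution g f (suc n)                     ∎

  conv-distribʳ : ∀ h f g n → convolution (λ k → f k + g k) h n ≡ convolution f h n + convolution g h n
  conv-distribʳ h f g zero    = ℤ.*-distribʳ-+ (h 0) (f 0) (g 0)
  conv-distribʳ h f g (suc n) = begin
    (f 0 + g 0) * h (suc n) + convolution (λ k → f (suc k) + g (suc k)) h n
      ≡⟨ cong (λ z → (f 0 + g 0) * h (suc n) + z) (conv-distribʳ h (f ∘ suc) (g ∘ suc) n) ⟩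
    (f 0 + g 0) * h (suc n) + (convolution (f ∘ suc) h n + convolution (g ∘ suc) h n)
      ≡⟨ solve 5 (λ a b c d e → (a :+ b) :* c :+ (d :+ e) := (a :* c :+ d) :+ (b :* c :+ e)) refl
           (f 0) (g 0) (h (suc n)) (convolution (f ∘ suc) h n) (convolution (g ∘ suc) h n) ⟩
    convolution f h (suc n) + convolution g h (suc n) ∎

  conv-scale : ∀ a f g n → convolution (λ k → a * f k) g n ≡ a * convolution f g n
  conv-scale a f g zero    = ℤ.*-assoc a (f 0) (g 0)
  conv-scale a f g (suc n) = begin
    a * f 0 * g (suc n) + convolution (λ k → a * f (suc k)) g n
      ≡⟨ cong (λ z → a * f 0 * g (suc n) + z) (conv-scale a (f ∘ suc) g n) ⟩
    a * f 0 * g (suc n) + a * convolution (f ∘ suc) g n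
      ≡⟨ solve 4 (λ a b c d → a :* b :* c :+ a :* d := a :* (b :* c :+ d)) refl
           a (f 0) (g (suc n)) (convolution (f ∘ suc) g n) ⟩
    a * convolution f g (suc n) ∎

  conv-assoc : ∀ f g h n → convolution (convolution f g) h n ≡ convolution f (convolution g h) n
  conv-assoc f g h zero    = ℤ.*-assoc (f 0) (g 0) (h 0)
  conv-assoc f g h (suc n) = begin
    f 0 * g 0 * h (suc n) + convolution (λ k → f 0 * g (suc k) + convolution (f ∘ suc) g k) h n
      ≡⟨ cong (λ z → f 0 * g 0 * h (suc n) + z) (conv-distribʳ h (λ k → f 0 * g (suc k)) (convolution (f ∘ suc) g) n) ⟩
    f 0 * g 0 * h (suc n) + (convolution (λ k → f 0 * g (suc k)) h n + convolution (convolution (f ∘ suc) g) h n)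
      ≡⟨ cong (λ z → f 0 * g 0 * h (suc n) + z)
           (cong₂ _+_ (conv-scale (f 0) (g ∘ suc) h n) (conv-assoc (f ∘ suc) g h n)) ⟩
    f 0 * g 0 * h (suc n) + (f 0 * convolution (g ∘ suc) h n + convolution (f ∘ suc) (convolution g h) n)
      ≡⟨ solve 5 (λ a b c d e → a :* b :* c :+ (a :* d :+ e) := a :* (b :* c :+ d) :+ e) refl
           (f 0) (g 0) (h (suc n)) (convolution (g ∘ suc) h n) (convolution (f ∘ suc) (convolution g h) n) ⟩
    f 0 * convolution g h (suc n) + convolution (f ∘ suc) (convolution g h) n ∎

  conv-zeroˡ : ∀ g n → convolution (λ _ → 0ℤ) g n ≡ 0ℤ
  conv-zeroˡ g zero    = refl
  conv-zeroˡ g (suc n) = trans (ℤ.+-identityˡ _) (conv-zeroˡ g n)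

  -- The two indices in each summand add up to n, so the power of r can be shared between the
  -- factors. With r = -1 this removes the alternating signs from the recurrence of `u`.
  conv-geometric : ∀ r f g n → r ^ n * convolution f g n ≡ convolution (λ k → r ^ k * f k) (λ k → r ^ k * g k) n
  conv-geometric r f g zero    = solve 2 (λ a b → con 1ℤ :* (a :* b) := (con 1ℤ :* a) :* (con 1ℤ :* b)) refl (f 0) (g 0)
  conv-geometric r f g (suc n) = begin
    r * r ^ n * (f 0 * g (suc n) + convolution (f ∘ suc) g n)
      ≡⟨ solve 5 (λ r s a b c → r :* s :* (a :* b :+ c) := con 1ℤ :* a :* (r :* s :* b) :+ r :* (s :* c)) refl
           r (r ^ n) (f 0) (g (suc n)) (convolution (f ∘ suc) g n) ⟩
    1ℤ * f 0 * (r * r ^ n * g (suc n)) + r * (r ^ n * convolution (f ∘ suc) g n)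
      ≡⟨ cong (λ z → 1ℤ * f 0 * (r * r ^ n * g (suc n)) + r * z) (conv-geometric r (f ∘ suc) g n) ⟩
    1ℤ * f 0 * (r * r ^ n * g (suc n)) + r * convolution (λ k → r ^ k * f (suc k)) (λ k → r ^ k * g k) n
      ≡⟨ cong (λ z → 1ℤ * f 0 * (r * r ^ n * g (suc n)) + z) (conv-scale r (λ k → r ^ k * f (suc k)) _ n) ⟨
    1ℤ * f 0 * (r * r ^ n * g (suc n)) + convolution (λ k → r * (r ^ k * f (suc k))) (λ k → r ^ k * g k) n
      ≡⟨ cong (λ z → 1ℤ * f 0 * (r * r ^ n * g (suc n)) + z)
           (conv-cong n (λ {k} _ → sym (ℤ.*-assoc r (r ^ k) (f (suc k)))) (λ _ → refl)) ⟩
    convolution (λ k → r ^ k * f k) (λ k → r ^ k * g k) (suc n) ∎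

opaque
  unfolding _⊕_

  ⊕-at : ∀ f g n → (f ⊕ g) n ≡ f n + g n
  ⊕-at f g n = refl

  ⊝-at : ∀ f n → (⊝ f) n ≡ - f n
  ⊝-at f n = refl

  ⊗-at : ∀ f g n → (f ⊗ g) n ≡ convolution f g n
  ⊗-at f g n = refl

  const-0 : ∀ a → const a 0 ≡ a
  const-0 a = refl

  const-suc : ∀ a n → const a (suc n) ≡ 0ℤ
  const-suc a n = refl

  const-⊗-at : ∀ a f n → (const a ⊗ f) n ≡ a * f n
  const-⊗-at a f zero    = refl
  const-⊗-at a f (suc n) = trans (cong (λ z → a * f (suc n) + z) (conv-zeroˡ f n)) (ℤ.+-identityʳ _)

  X⊗-0 : ∀ f → (X ⊗ f) 0 ≡ 0ℤ
  X⊗-0 f = refl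

  X⊗-suc : ∀ f n → (X ⊗ f) (suc n) ≡ f n
  X⊗-suc f n = trans (ℤ.+-identityˡ _) (trans (1-conv n) (ℤ.*-identityˡ (f n)))
    where
    1-conv : ∀ n → convolution (X ∘ suc) f n ≡ 1ℤ * f n
    1-conv zero    = refl
    1-conv (suc n) = trans (cong (λ z → 1ℤ * f (suc n) + z) (conv-zeroˡ f n)) (ℤ.+-identityʳ _)

  ⊕-⊗-isCommutativeRing : IsCommutativeRing _≈_ _⊕_ _⊗_ ⊝_ (const 0ℤ) (const 1ℤ)
  ⊕-⊗-isCommutativeRing = record
      { isRing = record
        { +-isAbelianGroup = record
          { isGroup = record
            { isMonoid = record
              { isSemigroup = record
                { isMagma = record
                  { isEquivalence = record
                    { refl  = pointwise λ n → refl
                    ; sym   = λ p → pointwise λ n → sym (at p n)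
                    ; trans = λ p q → pointwise λ n → trans (at p n) (at q n)
                    }
                  ; ∙-cong = λ p q → pointwise λ n → cong₂ _+_ (at p n) (at q n)
                  }
                ; assoc = λ f g h → pointwise λ n → ℤ.+-assoc (f n) (g n) (h n)
                }
              ; identity = (λ f → pointwise λ n → trans (cong₂ _+_ (const-zero n) refl) (ℤ.+-identityˡ (f n)))
                         , (λ f → pointwise λ n → trans (cong (λ z → f n + z) (const-zero n)) (ℤ.+-identityʳ (f n)))
              }
            ; inverse = (λ f → pointwise λ n → trans (ℤ.+-inverseˡ (f n)) (sym (const-zero n)))
                      , (λ f → pointwise λ n → trans (ℤ.+-inverseʳ (f n)) (sym (const-zero n)))
            ; ⁻¹-cong = λ p → pointwise λ n → cong -_ (at p n)
            }
          ; comm = λ f g → pointwise λ n → ℤ.+-comm (f n) (g n)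
          }
        ; *-cong = λ p q → pointwise λ n → conv-cong n (λ {k} _ → at p k) (λ {k} _ → at q k)
        ; *-assoc = λ f g h → pointwise (conv-assoc f g h)
        ; *-identity = ⊗-identityˡ
                     , (λ f → pointwise λ n → trans (conv-comm f (const 1ℤ) n) (at (⊗-identityˡ f) n))
        ; distrib = (λ h f g → pointwise λ n → trans (conv-comm h (f ⊕ g) n) (trans (conv-distribʳ h f g n)
                      (cong₂ _+_ (conv-comm f h n) (conv-comm g h n))))
                  , (λ h f g → pointwise (conv-distribʳ h f g))
        }
      ; *-comm = λ f g → pointwise (conv-comm f g)
      }
    where
    const-zero : ∀ n → const 0ℤ n ≡ 0ℤ
    const-zero zero    = refl
    const-zero (suc n) = refl
    ⊗-identityˡ : ∀ f → const 1ℤ ⊗ f ≈ f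
    ⊗-identityˡ f = pointwise λ n → trans (const-⊗-at 1ℤ f n) (ℤ.*-identityˡ (f n))


  const-homo-+ : ∀ a b → const (a + b) ≈ const a ⊕ const b
  const-homo-+ a b = pointwise λ { zero → refl ; (suc n) → refl }

  const-homo-* : ∀ a b → const (a * b) ≈ const a ⊗ const b
  const-homo-* a b = pointwise λ where
    zero    → refl
    (suc n) → sym (trans (const-⊗-at a (const b) (suc n)) (ℤ.*-zeroʳ a))

  const-homo-- : ∀ a → const (- a) ≈ ⊝ const a
  const-homo-- a = pointwise λ { zero → refl ; (suc n) → refl }

seriesRing : CommutativeRing 0ℓ 0ℓ
seriesRing = record { isCommutativeRing = ⊕-⊗-isCommutativeRing }

open CommutativeRing seriesRing
  using () renaming
  (refl to ≈-refl; sym to ≈-sym; trans to ≈-trans; +-cong to ⊕-cong; *-cong to ⊗-cong)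

constHomomorphism : +-*-rawRing -Raw-AlmostCommutative⟶ fromCommutativeRing seriesRing
constHomomorphism = record
  { ⟦_⟧    = const
  ; +-homo = const-homo-+
  ; *-homo = const-homo-*
  ; -‿homo = const-homo--
  ; 0-homo = ≈-refl
  ; 1-homo = ≈-refl
  }

module Solver = Algebra.Solver.Ring +-*-rawRing (fromCommutativeRing seriesRing) constHomomorphism
  (λ a b → Maybe.map (λ a≡b → pointwise λ n → cong (λ z → const z n) a≡b) (dec⇒maybe (a ℤ.≟ b)))

-- Power series equations

module _ where
  open CommutativeRing seriesRing using (-‿inverseʳ; +-congˡ; +-congʳ; +-assoc; +-identityʳ; *-congˡ)

  ⊕-cancelʳ : ∀ {f g} h → f ⊕ h ≈ g ⊕ h → f ≈ g
  ⊕-cancelʳ {f} {g} h p = ≈-trans (≈-sym (lemma f)) (≈-trans (+-congʳ p) (lemma g))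
    where
    lemma : ∀ k → k ⊕ h ⊕ ⊝ h ≈ k
    lemma k = ≈-trans (+-assoc k h (⊝ h)) (≈-trans (+-congˡ (-‿inverseʳ h)) (+-identityʳ k))

  -- Reduces f ≈ g to a ring identity f - g = q (b - a), which the solver can check.
  linearCombination : ∀ {f g a b q} → a ≈ b → f ⊕ q ⊗ a ≈ g ⊕ q ⊗ b → f ≈ g
  linearCombination a≈b p = ⊕-cancelʳ _ (≈-trans p (+-congˡ (*-congˡ (≈-sym a≈b))))

  linearCombination₂ : ∀ {f g a b q a′ b′ q′} → a ≈ b → a′ ≈ b′ →
                       f ⊕ q ⊗ a ⊕ q′ ⊗ a′ ≈ g ⊕ q ⊗ b ⊕ q′ ⊗ b′ → f ≈ g
  linearCombination₂ a≈b a′≈b′ p = linearCombination a≈b (linearCombination a′≈b′ p)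

  linearCombination₃ : ∀ {f g a b q a′ b′ q′ a″ b″ q″} → a ≈ b → a′ ≈ b′ → a″ ≈ b″ →
                       f ⊕ q ⊗ a ⊕ q′ ⊗ a′ ⊕ q″ ⊗ a″ ≈ g ⊕ q ⊗ b ⊕ q′ ⊗ b′ ⊕ q″ ⊗ b″ → f ≈ g
  linearCombination₃ a≈b a′≈b′ a″≈b″ p = linearCombination a≈b (linearCombination₂ a′≈b′ a″≈b″ p)

⊕X⊗-0 : ∀ f g → (f ⊕ X ⊗ g) 0 ≡ f 0
⊕X⊗-0 f g = trans (⊕-at f (X ⊗ g) 0) (trans (cong (λ z → f 0 + z) (X⊗-0 g)) (ℤ.+-identityʳ (f 0)))

⊕X⊗-suc : ∀ f g n → (f ⊕ X ⊗ g) (suc n) ≡ f (suc n) + g n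
⊕X⊗-suc f g n = trans (⊕-at f (X ⊗ g) (suc n)) (cong (λ z → f (suc n) + z) (X⊗-suc g n))

const⊕X⊗-suc : ∀ a g n → (const a ⊕ X ⊗ g) (suc n) ≡ g n
const⊕X⊗-suc a g n =
  trans (⊕X⊗-suc (const a) g n) (trans (cong (_+ g n) (const-suc a n)) (ℤ.+-identityˡ (g n)))

head-tail : ∀ f → f ≈ const (f 0) ⊕ X ⊗ (f ∘ suc)
head-tail f = pointwise λ where
  zero    → sym (trans (⊕X⊗-0 (const (f 0)) (f ∘ suc)) (const-0 (f 0)))
  (suc n) → sym (const⊕X⊗-suc (f 0) (f ∘ suc) n)

X⊗-cancel : ∀ {f g} → X ⊗ f ≈ X ⊗ g → f ≈ g
X⊗-cancel {f} {g} p = pointwise λ n →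
  trans (sym (X⊗-suc f n)) (trans (at p (suc n)) (X⊗-suc g n))

-- The unknown Z (σ i) enters with a factor X, so each coefficient is determined by earlier ones.
module _ {I : Set} (σ : I → I) (h p : I → Series) {Z Z′ : I → Series}
         (eq  : ∀ i → Z i  ≈ p i ⊕ X ⊗ (h i ⊗ Z (σ i)))
         (eq′ : ∀ i → Z′ i ≈ p i ⊕ X ⊗ (h i ⊗ Z′ (σ i))) where

  fixpoint-unique : ∀ i → Z i ≈ Z′ i
  fixpoint-unique i = pointwise λ n → <-rec (λ n → ∀ i → Z i n ≡ Z′ i n) step n i
    where
    step : ∀ n → (∀ {m} → m < n → ∀ i → Z i m ≡ Z′ i m) → ∀ i → Z i n ≡ Z′ i n
    step zero    _   i = trans (trans (at (eq i) 0) (⊕X⊗-0 _ _)) (sym (trans (at (eq′ i) 0) (⊕X⊗-0 _ _)))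
    step (suc n) rec i = begin
      Z i (suc n)                       ≡⟨ trans (at (eq i) (suc n)) (⊕X⊗-suc _ _ n) ⟩
      p i (suc n) + (h i ⊗ Z (σ i)) n   ≡⟨ cong (λ z → p i (suc n) + z) tails ⟩
      p i (suc n) + (h i ⊗ Z′ (σ i)) n  ≡⟨ trans (at (eq′ i) (suc n)) (⊕X⊗-suc _ _ n) ⟨
      Z′ i (suc n)                      ∎
      where
      open ≡-Reasoning
      tails : (h i ⊗ Z (σ i)) n ≡ (h i ⊗ Z′ (σ i)) n
      tails = trans (⊗-at _ _ n) (trans (conv-cong n (λ _ → refl) (λ k≤n → rec (s≤s k≤n) (σ i))) (sym (⊗-at _ _ n)))

solution-unique : ∀ p h {f g} → f ≈ p ⊕ X ⊗ (h ⊗ f) → g ≈ p ⊕ X ⊗ (h ⊗ g) → f ≈ g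
solution-unique p h {f} {g} f≈ g≈ =
  fixpoint-unique {⊤} (λ i → i) (λ _ → h) (λ _ → p) {λ _ → f} {λ _ → g} (λ _ → f≈) (λ _ → g≈) tt

-- The recurrence alone does not determine a family, so the member at 0 is prescribed. The
-- coefficient of xⁿ at `suc k` then depends on the one at k and on a coefficient of lower degree,
-- hence the recursion on n outside and on k inside.
ballot-unique : ∀ {T U : ℕ → Series} → T 0 ≈ U 0 →
                (∀ k → T (suc k) ≈ T k ⊕ X ⊗ T (2 ℕ.+ k)) →
                (∀ k → U (suc k) ≈ U k ⊕ X ⊗ U (2 ℕ.+ k)) →
                ∀ k → T k ≈ U k
ballot-unique {T} {U} T₀≈U₀ T-rec U-rec k = pointwise λ n → go n k
  where
  go : ∀ n k → T k n ≡ U k n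
  go n       zero    = at T₀≈U₀ n
  go zero    (suc k) = trans (trans (at (T-rec k) 0) (⊕X⊗-0 _ _))
    (trans (go zero k) (sym (trans (at (U-rec k) 0) (⊕X⊗-0 _ _))))
  go (suc n) (suc k) = trans (trans (at (T-rec k) (suc n)) (⊕X⊗-suc _ _ n))
    (trans (cong₂ _+_ (go (suc n) k) (go n (2 ℕ.+ k))) (sym (trans (at (U-rec k) (suc n)) (⊕X⊗-suc _ _ n))))

-- Binomials, Catalan and Fine numbers

S : ℕ → Series
S k n = + ((2 ℕ.* n ℕ.+ k) C n)

-- P k turns out to be the k-th power of the Catalan series c = P 1; its coefficients are
-- the ballot numbers, differences of neighbouring binomials.
P : ℕ → Series
P zero    = const 1ℤ
P (suc k) = S k ⊕ ⊝ (X ⊗ S (2 ℕ.+ k))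

c : Series
c = P 1

pascal : ∀ n k → (2 ℕ.* suc n ℕ.+ suc k) C suc n ≡
         (2 ℕ.* suc n ℕ.+ k) C suc n ℕ.+ (2 ℕ.* n ℕ.+ (2 ℕ.+ k)) C n
pascal n k = begin
  (2 ℕ.* suc n ℕ.+ suc k) C suc n        ≡⟨ cong (_C suc n) (ℕ.+-suc (2 ℕ.* suc n) k) ⟩
  suc N C suc n                          ≡⟨ nCk+nC[k+1]≡[n+1]C[k+1] N n ⟨
  N C n ℕ.+ N C suc n                    ≡⟨ ℕ.+-comm (N C n) (N C suc n) ⟩
  N C suc n ℕ.+ N C n
    ≡⟨ cong (λ M → N C suc n ℕ.+ M C n)
         (solve 2 (λ n k → con 2 :* (con 1 :+ n) :+ k := con 2 :* n :+ (con 2 :+ k)) refl n k) ⟩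
  N C suc n ℕ.+ (2 ℕ.* n ℕ.+ (2 ℕ.+ k)) C n ∎
  where
  open ≡-Reasoning
  open ℕ.+-*-Solver
  N = 2 ℕ.* suc n ℕ.+ k

S-rec : ∀ k → S (suc k) ≈ S k ⊕ X ⊗ S (2 ℕ.+ k)
S-rec k = pointwise λ where
  zero    → sym (⊕X⊗-0 (S k) (S (2 ℕ.+ k)))
  (suc n) → trans (cong +_ (pascal n k)) (sym (⊕X⊗-suc (S k) (S (2 ℕ.+ k)) n))

central : ∀ n → (2 ℕ.* suc n ℕ.+ 0) C suc n ≡ 2 ℕ.* ((2 ℕ.* n ℕ.+ 1) C n)
central n = begin
  (2 ℕ.* suc n ℕ.+ 0) C suc n
    ≡⟨ cong (_C suc n) (solve 1 (λ n → con 2 :* (con 1 :+ n) :+ con 0 := con 1 :+ (con 2 :* n :+ con 1)) refl n) ⟩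
  suc N C suc n                ≡⟨ nCk+nC[k+1]≡[n+1]C[k+1] N n ⟨
  N C n ℕ.+ N C suc n          ≡⟨ cong (N C n ℕ.+_) (nCk≡nC[n∸k] suc-n≤N) ⟩
  N C n ℕ.+ N C (N ∸ suc n)    ≡⟨ cong (λ k → N C n ℕ.+ N C k) N∸suc-n≡n ⟩
  N C n ℕ.+ N C n              ≡⟨ cong (N C n ℕ.+_) (ℕ.+-identityʳ (N C n)) ⟨
  2 ℕ.* (N C n)                ∎
  where
  open ≡-Reasoning
  open ℕ.+-*-Solver
  N = 2 ℕ.* n ℕ.+ 1
  N≡ : N ≡ n ℕ.+ suc n
  N≡ = solve 1 (λ n → con 2 :* n :+ con 1 := n :+ (con 1 :+ n)) refl n
  suc-n≤N : suc n ≤ N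
  suc-n≤N = subst (suc n ≤_) (sym N≡) (ℕ.m≤n+m (suc n) n)
  N∸suc-n≡n : N ∸ suc n ≡ n
  N∸suc-n≡n = trans (cong (_∸ suc n) N≡) (ℕ.m+n∸n≡m n (suc n))

S₀-rec : S 0 ≈ const 1ℤ ⊕ X ⊗ (const (+ 2) ⊗ S 1)
S₀-rec = pointwise λ where
  zero    → sym (trans (⊕X⊗-0 _ _) (const-0 1ℤ))
  (suc n) → trans (cong +_ (central n)) (trans (ℤ.pos-* 2 ((2 ℕ.* n ℕ.+ 1) C n)) (sym (trans (const⊕X⊗-suc 1ℤ _ n) (const-⊗-at (+ 2) (S 1) n))))

module _ where
  open Solver

  -- For positive k this combines two instances of `S-rec`. At k = 0 the neighbour `P 0` is the
  -- constant 1 instead of a difference of binomials, and `S₀-rec` supplies the boundary value.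
  P-rec : ∀ k → P (suc k) ≈ P k ⊕ X ⊗ P (2 ℕ.+ k)
  P-rec zero    = linearCombination₂ S₀-rec (S-rec 1)
    (solve 5 (λ s₀ s₁ s₂ s₃ x →
       s₀ :+ :- (x :* s₂) :+ con -1ℤ :* s₀ :+ x :* s₂ :=
       con 1ℤ :+ x :* (s₁ :+ :- (x :* s₃)) :+ con -1ℤ :* (con 1ℤ :+ x :* (con (+ 2) :* s₁)) :+ x :* (s₁ :+ x :* s₃))
     ≈-refl (S 0) (S 1) (S 2) (S 3) X)
  P-rec (suc k) = linearCombination₂ (S-rec k) (S-rec (2 ℕ.+ k))
    (solve 6 (λ s₀ s₁ s₂ s₃ s₄ x →
       s₁ :+ :- (x :* s₃) :+ con -1ℤ :* s₁ :+ x :* s₃ :=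
       s₀ :+ :- (x :* s₂) :+ x :* (s₂ :+ :- (x :* s₄)) :+ con -1ℤ :* (s₀ :+ x :* s₂) :+ x :* (s₂ :+ x :* s₄))
     ≈-refl (S k) (S (1 ℕ.+ k)) (S (2 ℕ.+ k)) (S (3 ℕ.+ k)) (S (4 ℕ.+ k)) X)

  -- Multiplication by c preserves the linear recurrence `P-rec`, and both families start with c.
  -- Thus no convolution identity for binomials is needed.
  P-suc : ∀ k → P (suc k) ≈ c ⊗ P k
  P-suc = ballot-unique (solve 1 (λ c → c := c :* con 1ℤ) ≈-refl c) (P-rec ∘ suc) λ k →
    linearCombination (P-rec k)
      (solve 5 (λ c p₀ p₁ p₂ x → c :* p₁ :+ :- c :* p₁ := c :* p₀ :+ x :* (c :* p₂) :+ :- c :* (p₀ :+ x :* p₂))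
       ≈-refl c (P k) (P (1 ℕ.+ k)) (P (2 ℕ.+ k)) X)

  c-equation : c ≈ const 1ℤ ⊕ X ⊗ (c ⊗ c)
  c-equation = linearCombination₂ (P-rec 0) (P-suc 1)
    (solve 3 (λ c p₂ x → c :+ con -1ℤ :* c :+ :- x :* p₂ :=
       con 1ℤ :+ x :* (c :* c) :+ con -1ℤ :* (con 1ℤ :+ x :* p₂) :+ :- x :* (c :* c))
     ≈-refl c (P 2) X)

  -- `ballot-unique` would require S 1 = c S 0 in advance. Instead P (1 + k) = S k - x S (2 + k) is
  -- read as an equation determining the S k, and multiplying it by c turns P (1 + k) into P (2 +
  -- k).
  S-suc : ∀ k → S (suc k) ≈ c ⊗ S k
  S-suc = fixpoint-unique (2 ℕ.+_) (λ _ → const 1ℤ) (λ k → P (2 ℕ.+ k))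
    (λ k → solve 3 (λ s₁ s₃ x → s₁ := s₁ :+ :- (x :* s₃) :+ x :* (con 1ℤ :* s₃)) ≈-refl (S (1 ℕ.+ k)) (S (3 ℕ.+ k)) X)
    (λ k → linearCombination (P-suc (suc k))
      (solve 5 (λ c s₀ s₂ p₂ x → c :* s₀ :+ con 1ℤ :* p₂ :=
         p₂ :+ x :* (con 1ℤ :* (c :* s₂)) :+ con 1ℤ :* (c :* (s₀ :+ :- (x :* s₂))))
       ≈-refl c (S k) (S (2 ℕ.+ k)) (P (2 ℕ.+ k)) X))

-- stack s is the sum of x^(2k) s k over all k.
stack : (ℕ → Series) → Series
stack s 0             = s 0 0
stack s 1             = s 0 1
stack s (suc (suc n)) = s 0 (suc (suc n)) + stack (s ∘ suc) n

stack-unfold : ∀ s → stack s ≈ s 0 ⊕ X ⊗ (X ⊗ stack (s ∘ suc))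
stack-unfold s = pointwise λ where
  0 → sym (⊕X⊗-0 (s 0) _)
  1 → sym (trans (⊕X⊗-suc (s 0) _ 0) (trans (cong (λ z → s 0 1 + z) (X⊗-0 _)) (ℤ.+-identityʳ (s 0 1))))
  (suc (suc n)) → sym (trans (⊕X⊗-suc (s 0) _ (suc n)) (cong (λ z → s 0 (2 ℕ.+ n) + z) (X⊗-suc _ n)))

module _ (h : Series) where
  open Solver

  Geometric : (ℕ → Series) → Set
  Geometric s = ∀ k → s (suc k) ≈ h ⊗ s k

  -- The infinite sum is not multiplied term by term. As functions of the family, both sides satisfy
  -- the same equation linking a family to its shift, so the index set consists of the geometric
  -- families.
  stack-tail : ∀ s → Geometric s → stack (s ∘ suc) ≈ h ⊗ stack s
  stack-tail s s-geo = fixpoint-unique {Σ[ s ∈ _ ] Geometric s}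
    (λ (s , s-geo) → s ∘ suc , s-geo ∘ suc) (λ _ → X) (λ (s , _) → s 1)
    {λ (s , _) → stack (s ∘ suc)} {λ (s , _) → h ⊗ stack s}
    (λ (s , _) → stack-unfold (s ∘ suc))
    (λ (s , s-geo) → linearCombination₂ (s-geo 0) (stack-unfold s)
      (solve 6 (λ h z z′ s₀ s₁ x →
         h :* z :+ con 1ℤ :* s₁ :+ :- h :* z :=
         s₁ :+ x :* (x :* (h :* z′)) :+ con 1ℤ :* (h :* s₀) :+ :- h :* (s₀ :+ x :* (x :* z′)))
       ≈-refl h (stack s) (stack (s ∘ suc)) (s 0) (s 1) X))
    (s , s-geo)

  stack-geometric : ∀ s → Geometric s → stack s ≈ s 0 ⊕ X ⊗ (X ⊗ (h ⊗ stack s))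
  stack-geometric s s-geo = linearCombination₂ (stack-unfold s) (stack-tail s s-geo)
    (solve 5 (λ h z z′ s₀ x →
       z :+ con -1ℤ :* z :+ :- (x :* x) :* z′ :=
       s₀ :+ x :* (x :* (h :* z)) :+ con -1ℤ :* (s₀ :+ x :* (x :* z′)) :+ :- (x :* x) :* (h :* z))
     ≈-refl h (stack s) (stack (s ∘ suc)) (s 0) X)

-- Exactly the ⌊n/2⌋ + 1 terms with 2k ≤ n reach the coefficient of xⁿ, and for these the
-- subtraction is exact.
sum-stack : ∀ (t : ℕ → ℕ) s n → (∀ k → k ℕ.* 2 ≤ n → + t k ≡ s k (n ∸ k ℕ.* 2)) →
            + sumℕ {suc ⌊ n /2⌋} (λ k → t (toℕ k)) ≡ stack s n
sum-stack t s 0 t≡s = trans (cong +_ (ℕ.+-identityʳ (t 0))) (t≡s 0 z≤n)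
sum-stack t s 1 t≡s = trans (cong +_ (ℕ.+-identityʳ (t 0))) (t≡s 0 z≤n)
sum-stack t s (suc (suc n)) t≡s =
  cong₂ _+_ (t≡s 0 z≤n) (sum-stack (t ∘ suc) (s ∘ suc) n (λ k k*2≤n → t≡s (suc k) (s≤s (s≤s k*2≤n))))

R F G H J : Series
R   = stack (λ k → S (k ℕ.* 2))
F n = fine (1 ℕ.+ n)
G n = fine (2 ℕ.+ n)
H n = fine (3 ℕ.+ n)
J n = fine (4 ℕ.+ n)

binomialSum : ℕ → ℕ
binomialSum n = ∑ℕ ⌊ suc n ℕ.+ 1 /2⌋ λ k → (2 ℕ.* suc n ∸ 2 ℕ.* k) C n

-- Put r = n - 2k, with k one less than the index in `fine`. The summand is the binomial of 2r + 2k
-- over n = 2k + r, by symmetry the one over r, which is the coefficient of x^r in S (2k).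
fine-sum : ∀ n → + binomialSum n ≡ R n
fine-sum n = trans (cong (λ m → + (∑ℕ m λ k → (2 ℕ.* suc n ∸ 2 ℕ.* k) C n)) (cong ⌊_/2⌋ (ℕ.+-comm (suc n) 1)))
  (sum-stack (λ k → (2 ℕ.* suc n ∸ 2 ℕ.* suc k) C n) (λ k → S (k ℕ.* 2)) n (λ k k*2≤n → cong +_ (term n k k*2≤n)))
  where
  open ℕ.+-*-Solver
  term′ : ∀ k r → (2 ℕ.* suc (k ℕ.* 2 ℕ.+ r) ∸ 2 ℕ.* suc k) C (k ℕ.* 2 ℕ.+ r) ≡ (2 ℕ.* r ℕ.+ k ℕ.* 2) C r
  term′ k r = begin
    (2 ℕ.* suc m ∸ 2 ℕ.* suc k) C m
      ≡⟨ cong (λ N → (N ∸ 2 ℕ.* suc k) C m) (solve 2 (λ k r →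
           con 2 :* (con 1 :+ (k :* con 2 :+ r)) := (con 2 :* r :+ k :* con 2) :+ con 2 :* (con 1 :+ k)) refl k r) ⟩
    (M ℕ.+ 2 ℕ.* suc k ∸ 2 ℕ.* suc k) C m ≡⟨ cong (_C m) (ℕ.m+n∸n≡m M (2 ℕ.* suc k)) ⟩
    M C m                                 ≡⟨ nCk≡nC[n∸k] m≤M ⟩
    M C (M ∸ m)                           ≡⟨ cong (M C_) (trans (cong (_∸ m) M≡) (ℕ.m+n∸n≡m r m)) ⟩
    M C r                                 ∎
    where
    open ≡-Reasoning
    m = k ℕ.* 2 ℕ.+ r
    M = 2 ℕ.* r ℕ.+ k ℕ.* 2
    M≡ : M ≡ r ℕ.+ m
    M≡ = solve 2 (λ k r → con 2 :* r :+ k :* con 2 := r :+ (k :* con 2 :+ r)) refl k r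
    m≤M : m ≤ M
    m≤M = subst (m ≤_) (sym M≡) (ℕ.m≤n+m m r)
  term : ∀ n k → k ℕ.* 2 ≤ n → (2 ℕ.* suc n ∸ 2 ℕ.* suc k) C n ≡ (2 ℕ.* (n ∸ k ℕ.* 2) ℕ.+ k ℕ.* 2) C (n ∸ k ℕ.* 2)
  term n k k*2≤n = subst (λ m → (2 ℕ.* suc m ∸ 2 ℕ.* suc k) C m ≡ (2 ℕ.* (n ∸ k ℕ.* 2) ℕ.+ k ℕ.* 2) C (n ∸ k ℕ.* 2))
    (ℕ.m+[n∸m]≡n k*2≤n) (term′ k (n ∸ k ℕ.* 2))

F-expansion : F ≈ const (+ 3) ⊗ R ⊕ const (- + 2) ⊗ S 1
F-expansion = pointwise λ n → begin
  F n
    ≡⟨ cong₂ _+_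
         (trans (ℤ.pos-* 3 (binomialSum n)) (cong (+ 3 *_) (fine-sum n)))
         (cong -_ (trans (cong (λ m → + (m C suc n)) (sym (ℕ.+-identityʳ (2 ℕ.* suc n)))) (cong +_ (central n)))) ⟩
  + 3 * R n + - + (2 ℕ.* ((2 ℕ.* n ℕ.+ 1) C n))
    ≡⟨ cong (λ z → + 3 * R n + z) (trans (cong -_ (ℤ.pos-* 2 ((2 ℕ.* n ℕ.+ 1) C n))) (ℤ.neg-distribˡ-* (+ 2) (S 1 n))) ⟩
  + 3 * R n + - + 2 * S 1 n
    ≡⟨ trans (⊕-at _ _ n) (cong₂ _+_ (const-⊗-at (+ 3) R n) (const-⊗-at (- + 2) (S 1) n)) ⟨
  (const (+ 3) ⊗ R ⊕ const (- + 2) ⊗ S 1) n ∎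
  where open ≡-Reasoning


module _ where
  open Solver

  -- From c (1 - x c) = 1 follows c (1 - x² c²) = 1 + x c. As (1 - x² c²) R = S 0, multiplying F = 3
  -- R - 2 c S 0 by 1 - x² c² gives S 0 (3 - 2 (1 + x c)) = S 0 (1 - 2 x c) = 1.
  F-equation : F ≈ const 1ℤ ⊕ X ⊗ (X ⊗ (c ⊗ c ⊗ F))
  F-equation = linearCombination₂ F-expansion (stack-geometric (c ⊗ c) (λ k → S (k ℕ.* 2)) S-suc₂)
    (linearCombination₃ (S-suc 0) S₀-rec c-equation
    (solve 6 (λ f r s₀ s₁ c x →
       let y = con 1ℤ :+ :- (x :* x :* c :* c)
           q = :- y
           q′ = con (- + 3)
           q″ = con (+ 2) :* y :+ con (- + 2) :* x
           q‴ = con -1ℤ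
           q⁗ = con (+ 2) :* s₀ :* (con 1ℤ :+ x :* c)
       in f :+ q :* f :+ q′ :* r :+ q″ :* s₁ :+ q‴ :* s₀ :+ q⁗ :* c :=
          con 1ℤ :+ x :* (x :* (c :* c :* f)) :+ q :* (con (+ 3) :* r :+ con (- + 2) :* s₁)
            :+ q′ :* (s₀ :+ x :* (x :* (c :* c :* r))) :+ q″ :* (c :* s₀)
            :+ q‴ :* (con 1ℤ :+ x :* (con (+ 2) :* s₁)) :+ q⁗ :* (con 1ℤ :+ x :* (c :* c)))
     ≈-refl F R (S 0) (S 1) c X))
    where
    S-suc₂ : ∀ k → S (suc k ℕ.* 2) ≈ c ⊗ c ⊗ S (k ℕ.* 2)
    S-suc₂ k = linearCombination₂ (S-suc (suc (k ℕ.* 2))) (S-suc (k ℕ.* 2))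
      (solve 4 (λ s₀ s₁ s₂ c → s₂ :+ con -1ℤ :* s₂ :+ :- c :* s₁ :=
         c :* c :* s₀ :+ con -1ℤ :* (c :* s₁) :+ :- c :* (c :* s₀))
       ≈-refl (S (k ℕ.* 2)) (S (1 ℕ.+ k ℕ.* 2)) (S (2 ℕ.+ k ℕ.* 2)) c)

  F-tail : F ≈ const 1ℤ ⊕ X ⊗ G
  F-tail = head-tail F

  G-tail : G ≈ X ⊗ H
  -- The constant term of G is t₂, which evaluates to 0.
  G-tail = ≈-trans (head-tail G) (solve 2 (λ x h → con 0ℤ :+ x :* h := x :* h) ≈-refl X H)

  H-tail : H ≈ const 1ℤ ⊕ X ⊗ J
  H-tail = head-tail H

  H≈c²F : H ≈ c ⊗ c ⊗ F
  H≈c²F = X⊗-cancel (X⊗-cancel (linearCombination₃ F-equation F-tail G-tail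
    (solve 5 (λ f g h c x →
       x :* (x :* h) :+ con -1ℤ :* f :+ con 1ℤ :* f :+ x :* g :=
       x :* (x :* (c :* c :* f)) :+ con -1ℤ :* (con 1ℤ :+ x :* (x :* (c :* c :* f)))
         :+ con 1ℤ :* (con 1ℤ :+ x :* g) :+ x :* (x :* h))
     ≈-refl F G H c X)))

absorption : ∀ n k → suc k ℕ.* (suc n C suc k) ≡ suc n ℕ.* (n C k)
absorption zero    zero    = refl
absorption zero    (suc k) = ℕ.*-zeroʳ (2 ℕ.+ k)
absorption (suc n) zero    = trans (ℕ.*-identityˡ _) (trans (nC1≡n (2 ℕ.+ n)) (sym (ℕ.*-identityʳ (2 ℕ.+ n))))
absorption (suc n) (suc k) = begin
  (2 ℕ.+ k) ℕ.* ((2 ℕ.+ n) C (2 ℕ.+ k))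
    ≡⟨ cong ((2 ℕ.+ k) ℕ.*_) (nCk+nC[k+1]≡[n+1]C[k+1] (suc n) (suc k)) ⟨
  (2 ℕ.+ k) ℕ.* (a ℕ.+ b)
    ≡⟨ solve 3 (λ k a b → (con 2 :+ k) :* (a :+ b) := a :+ ((con 1 :+ k) :* a :+ (con 2 :+ k) :* b)) refl k a b ⟩
  a ℕ.+ (suc k ℕ.* a ℕ.+ (2 ℕ.+ k) ℕ.* b)
    ≡⟨ cong₂ (λ x y → a ℕ.+ (x ℕ.+ y)) (absorption n k) (absorption n (suc k)) ⟩
  a ℕ.+ (suc n ℕ.* (n C k) ℕ.+ suc n ℕ.* (n C suc k))
    ≡⟨ cong (a ℕ.+_) (ℕ.*-distribˡ-+ (suc n) (n C k) (n C suc k)) ⟨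
  a ℕ.+ suc n ℕ.* (n C k ℕ.+ n C suc k)
    ≡⟨ cong (λ z → a ℕ.+ suc n ℕ.* z) (nCk+nC[k+1]≡[n+1]C[k+1] n k) ⟩
  (2 ℕ.+ n) ℕ.* a ∎
  where
  open ≡-Reasoning
  open ℕ.+-*-Solver
  a = suc n C suc k
  b = suc n C (2 ℕ.+ k)

-- Absorption and Pascal's rule give (2 + m) a = (1 + m) b for the two neighbouring binomials, hence
-- (b - a) (2 + m) = b. This makes the division in `catalan` exact and identifies the quotient as a
-- ballot number.
catalan≡c : ∀ n → + catalan n ≡ c n
catalan≡c zero    = sym (trans (⊕-at (S 0) (⊝ (X ⊗ S 2)) 0)
  (cong (λ z → 1ℤ + z) (trans (⊝-at (X ⊗ S 2) 0) (cong -_ (X⊗-0 (S 2))))))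
catalan≡c (suc m) = begin
  + (b / (2 ℕ.+ m))                 ≡⟨ cong (λ z → + (z / (2 ℕ.+ m))) [b∸a]*[2+m]≡b ⟨
  + ((b ∸ a) ℕ.* (2 ℕ.+ m) / (2 ℕ.+ m)) ≡⟨ cong +_ (m*n/n≡m (b ∸ a) (2 ℕ.+ m)) ⟩
  + (b ∸ a)                         ≡⟨ trans (ℤ.m-n≡m⊖n b a) (ℤ.⊖-≥ a≤b) ⟨
  + b + - + a
    ≡⟨ cong₂ (λ M N → + (M C suc m) + - + (N C m)) (sym (ℕ.+-identityʳ N))
         (solve 1 (λ m → con 2 :* (con 1 :+ m) := con 2 :* m :+ con 2) refl m) ⟩
  S 0 (suc m) + - S 2 m             ≡⟨ cong (λ z → S 0 (suc m) + z)
                                         (trans (⊝-at (X ⊗ S 2) (suc m)) (cong -_ (X⊗-suc (S 2) m))) ⟨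
  S 0 (suc m) + (⊝ (X ⊗ S 2)) (suc m) ≡⟨ ⊕-at (S 0) (⊝ (X ⊗ S 2)) (suc m) ⟨
  c (suc m)                         ∎
  where
  open ≡-Reasoning
  open ℕ.+-*-Solver
  N = 2 ℕ.* suc m
  a = N C m
  b = N C suc m
  [2+m]*a≡[1+m]*b : (2 ℕ.+ m) ℕ.* a ≡ suc m ℕ.* b
  [2+m]*a≡[1+m]*b = ℕ.+-cancelˡ-≡ (suc m ℕ.* a) _ _ (begin
    suc m ℕ.* a ℕ.+ (2 ℕ.+ m) ℕ.* a
      ≡⟨ solve 2 (λ m a → (con 1 :+ m) :* a :+ (con 2 :+ m) :* a := (con 1 :+ con 2 :* (con 1 :+ m)) :* a) refl m a ⟩
    suc N ℕ.* a                     ≡⟨ absorption N m ⟨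
    suc m ℕ.* (suc N C suc m)       ≡⟨ cong (suc m ℕ.*_) (nCk+nC[k+1]≡[n+1]C[k+1] N m) ⟨
    suc m ℕ.* (a ℕ.+ b)             ≡⟨ ℕ.*-distribˡ-+ (suc m) a b ⟩
    suc m ℕ.* a ℕ.+ suc m ℕ.* b     ∎)
  a≤b : a ≤ b
  a≤b = ℕ.*-cancelˡ-≤ (2 ℕ.+ m) (subst (_≤ (2 ℕ.+ m) ℕ.* b) (sym [2+m]*a≡[1+m]*b) (ℕ.m≤n+m (suc m ℕ.* b) b))
  [b∸a]*[2+m]≡b : (b ∸ a) ℕ.* (2 ℕ.+ m) ≡ b
  [b∸a]*[2+m]≡b = begin
    (b ∸ a) ℕ.* (2 ℕ.+ m)                   ≡⟨ ℕ.*-distribʳ-∸ (2 ℕ.+ m) b a ⟩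
    b ℕ.* (2 ℕ.+ m) ∸ a ℕ.* (2 ℕ.+ m)       ≡⟨ cong₂ _∸_ (ℕ.*-comm b (2 ℕ.+ m)) (trans (ℕ.*-comm a (2 ℕ.+ m)) [2+m]*a≡[1+m]*b) ⟩
    b ℕ.+ suc m ℕ.* b ∸ suc m ℕ.* b         ≡⟨ ℕ.m+n∸n≡m b (suc m ℕ.* b) ⟩
    b                                       ∎

-- Hessenberg–Toeplitz determinants

det-cong : ∀ {n} {M N : Matrix n} → (∀ i j → M i j ≡ N i j) → det M ≡ det N
det-cong {zero}  M≡N = refl
det-cong {suc n} M≡N = sumℤ-cong λ j →
  cong₂ (λ a d → -1ℤ ^ toℕ j * a * d) (M≡N Fin.zero j) (det-cong λ i k → M≡N (Fin.suc i) (punchIn j k))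

module _ (a₀ : ℤ) (a : Series) where

  -- Structural recursion replaces the decidable comparisons, so that invariance along diagonals
  -- holds by computation and the minors below match by `refl`.
  entry : ℕ → ℕ → ℤ
  entry i       zero          = a i
  entry zero    (suc zero)    = a₀
  entry zero    (suc (suc j)) = 0ℤ
  entry (suc i) (suc j)       = entry i j

  entry-≤ : ∀ {i j} → j ≤ i → entry i j ≡ a (i ∸ j)
  entry-≤ z≤n       = refl
  entry-≤ (s≤s j≤i) = entry-≤ j≤i

  entry-suc : ∀ i → entry i (suc i) ≡ a₀
  entry-suc zero    = refl
  entry-suc (suc i) = entry-suc i

  entry-> : ∀ {i j} → ¬ j ≤ i → ¬ j ≡ suc i → entry i j ≡ 0ℤ
  entry-> {i}     {zero}        j≰i _    = contradiction z≤n j≰i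
  entry-> {zero}  {suc zero}    _   j≢1  = contradiction refl j≢1
  entry-> {zero}  {suc (suc j)} _   _    = refl
  entry-> {suc i} {suc j}       j≰i j≢si = entry-> (j≰i ∘ s≤s) (j≢si ∘ cong suc)

  hessenbergToeplitz-entry : ∀ {n} (i j : Fin n) →
    hessenbergToeplitz a₀ (a ∘ toℕ) i j ≡ entry (toℕ i) (toℕ j)
  hessenbergToeplitz-entry i j with toℕ j ℕ.≤? toℕ i | toℕ j ℕ.≟ suc (toℕ i)
  ... | yes j≤i | _       = trans (cong a (toℕ-fromℕ< _)) (sym (entry-≤ j≤i))
  ... | no  _   | yes j≡  = sym (trans (cong (entry (toℕ i)) j≡) (entry-suc (toℕ i)))
  ... | no  j≰i | no  j≢  = sym (entry-> j≰i j≢)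

  D : ℕ → ℤ
  D n = det {n} (hessenbergToeplitz a₀ (a ∘ toℕ))

  D-entry : ∀ n → det {n} (λ i j → entry (toℕ i) (toℕ j)) ≡ D n
  D-entry n = det-cong {n} λ i j → sym (hessenbergToeplitz-entry i j)

  -- The Hessenberg–Toeplitz matrix with its first column replaced: deleting the
  -- first row and the second column again gives a matrix of this shape.
  bordered : Series → ∀ {n} → Matrix n
  bordered f i Fin.zero    = f (toℕ i)
  bordered f i (Fin.suc j) = entry (toℕ i) (suc (toℕ j))

  det-bordered-1 : ∀ f → det {1} (bordered f) ≡ f 0
  det-bordered-1 f = solve 1 (λ x → con 1ℤ :* x :* con 1ℤ :+ con 0ℤ := x) refl (f 0)
    where open ℤ.+-*-Solver

  det-bordered-suc : ∀ f n → det {2 ℕ.+ n} (bordered f) ≡ f 0 * D (suc n) + - a₀ * det {suc n} (bordered (f ∘ suc))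
  det-bordered-suc f n = begin
    1ℤ * f 0 * det {suc n} (λ i j → entry (toℕ i) (toℕ j)) +
      (-1ℤ * 1ℤ * a₀ * det {suc n} (λ i j → bordered f (Fin.suc i) (punchIn (Fin.suc Fin.zero) j)) + rest)
      ≡⟨ cong₂ (λ x y → 1ℤ * f 0 * x + y) (D-entry (suc n))
           (cong₂ (λ x y → -1ℤ * 1ℤ * a₀ * x + y) (det-cong minor) rest≡0) ⟩
    1ℤ * f 0 * D (suc n) + (-1ℤ * 1ℤ * a₀ * det {suc n} (bordered (f ∘ suc)) + 0ℤ)
      ≡⟨ solve 4 (λ x d a e → con 1ℤ :* x :* d :+ (con -1ℤ :* con 1ℤ :* a :* e :+ con 0ℤ) := x :* d :+ :- a :* e)
           refl (f 0) (D (suc n)) a₀ (det {suc n} (bordered (f ∘ suc))) ⟩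
    f 0 * D (suc n) + - a₀ * det {suc n} (bordered (f ∘ suc)) ∎
    where
    open ≡-Reasoning
    open ℤ.+-*-Solver
    minor : ∀ (i j : Fin (suc n)) →
      bordered f (Fin.suc i) (punchIn (Fin.suc Fin.zero) j) ≡ bordered (f ∘ suc) i j
    minor i Fin.zero    = refl
    minor i (Fin.suc j) = refl
    cofactor : Fin n → ℤ
    cofactor j = det {suc n} λ i k → bordered f (Fin.suc i) (punchIn (Fin.suc (Fin.suc j)) k)
    rest : ℤ
    rest = sumℤ {n} λ j → -1ℤ ^ (2 ℕ.+ toℕ j) * 0ℤ * cofactor j
    rest≡0 : rest ≡ 0ℤ
    rest≡0 = trans
      (sumℤ-cong λ j → cong (_* cofactor j) (ℤ.*-zeroʳ (-1ℤ ^ (2 ℕ.+ toℕ j))))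
      (sum-replicate-zero n)

  module _ (a₀²≡1 : a₀ * a₀ ≡ 1ℤ) where

    signed : Series
    signed n = (- a₀) ^ n * D n

    -- Each expansion step contributes a factor -a₀ to the remaining determinant. The prefactor
    -- pairs these into powers of a₀² = 1, which leaves a plain convolution.
    det-bordered : ∀ f n → (- a₀) ^ n * det {suc n} (bordered f) ≡ convolution f signed n
    det-bordered f zero    = begin
      1ℤ * det {1} (bordered f) ≡⟨ cong (1ℤ *_) (det-bordered-1 f) ⟩
      1ℤ * f 0                  ≡⟨ ℤ.*-comm 1ℤ (f 0) ⟩
      f 0 * 1ℤ                  ∎
      where open ≡-Reasoning
    det-bordered f (suc n) = begin
      - a₀ * r * det {2 ℕ.+ n} (bordered f)
        ≡⟨ cong (λ z → - a₀ * r * z) (det-bordered-suc f n) ⟩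
      - a₀ * r * (f 0 * D (suc n) + - a₀ * d)
        ≡⟨ solve 5 (λ a r x y d → :- a :* r :* (x :* y :+ :- a :* d) := x :* (:- a :* r :* y) :+ a :* a :* (r :* d))
             refl a₀ r (f 0) (D (suc n)) d ⟩
      f 0 * (- a₀ * r * D (suc n)) + a₀ * a₀ * (r * d)
        ≡⟨ cong₂ (λ x y → f 0 * (- a₀ * r * D (suc n)) + x * y) a₀²≡1 (det-bordered (f ∘ suc) n) ⟩
      f 0 * (- a₀ * r * D (suc n)) + 1ℤ * convolution (f ∘ suc) signed n
        ≡⟨ cong (λ z → f 0 * (- a₀ * r * D (suc n)) + z) (ℤ.*-identityˡ (convolution (f ∘ suc) signed n)) ⟩
      f 0 * signed (suc n) + convolution (f ∘ suc) signed n ∎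
      where
      open ≡-Reasoning
      open ℤ.+-*-Solver
      r = (- a₀) ^ n
      d = det {suc n} (bordered (f ∘ suc))

    signed-suc : ∀ n → signed (suc n) ≡ - a₀ * (a ⊗ signed) n
    signed-suc n = begin
      - a₀ * (- a₀) ^ n * D (suc n)
        ≡⟨ ℤ.*-assoc (- a₀) ((- a₀) ^ n) (D (suc n)) ⟩
      - a₀ * ((- a₀) ^ n * D (suc n))
        ≡⟨ cong (λ z → - a₀ * ((- a₀) ^ n * z)) (trans (sym (D-entry (suc n))) (det-cong {suc n} toeplitz≡bordered)) ⟩
      - a₀ * ((- a₀) ^ n * det {suc n} (bordered a))
        ≡⟨ cong (- a₀ *_) (trans (det-bordered a n) (sym (⊗-at a signed n))) ⟩
      - a₀ * (a ⊗ signed) n ∎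
      where
      open ≡-Reasoning
      toeplitz≡bordered : ∀ {n} (i j : Fin n) → entry (toℕ i) (toℕ j) ≡ bordered a i j
      toeplitz≡bordered i Fin.zero    = refl
      toeplitz≡bordered i (Fin.suc j) = refl

    signed-equation : signed ≈ const 1ℤ ⊕ X ⊗ (const (- a₀) ⊗ (a ⊗ signed))
    signed-equation = pointwise λ where
      zero    → sym (trans (⊕X⊗-0 _ _) (const-0 1ℤ))
      (suc n) → trans (signed-suc n)
        (sym (trans (const⊕X⊗-suc 1ℤ _ n) (const-⊗-at (- a₀) (a ⊗ signed) n)))

-- Counting Dyck paths by returns

module _ {A B : Set} {P : Pred B 0ℓ} (P? : Decidable P) (f : A → B) where

  length-filter-map : ∀ xs → length (filter P? (map f xs)) ≡ length (filter (P? ∘ f) xs)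
  length-filter-map []       = refl
  length-filter-map (x ∷ xs) with P? (f x)
  ... | yes _ = cong suc (length-filter-map xs)
  ... | no  _ = length-filter-map xs

length-filter-none : ∀ {A : Set} {P : Pred A 0ℓ} (P? : Decidable P) → (∀ x → ¬ P x) →
                     ∀ xs → length (filter P? xs) ≡ 0
length-filter-none P? ¬P xs = cong length (filter-none P? (All.universal ¬P xs))

length-filter-≐ : ∀ {A : Set} {P Q : Pred A 0ℓ} (P? : Decidable P) (Q? : Decidable Q) → P ≐ Q →
                  ∀ xs → length (filter P? xs) ≡ length (filter Q? xs)
length-filter-≐ P? Q? P≐Q xs = cong length (filter-≐ P? Q? P≐Q xs)

-- Recursion on the first step needs arbitrary starting heights. At h = 0 this unfolds to the
-- predicate counted by `dyckWithReturns`.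
DyckFrom : (h j : ℕ) → List Step → Set
DyckFrom h j p = (All (0ℤ ℤ.≤_) (heights (+ h) p) × finalHeight (+ h) p ≡ 0ℤ) × returnsFrom (+ h) p ≡ j

dyckFrom? : ∀ h j p → Dec (DyckFrom h j p)
dyckFrom? h j p = (all? (0ℤ ℤ.≤?_) (heights (+ h) p) ×-dec (finalHeight (+ h) p ℤ.≟ 0ℤ)) ×-dec (returnsFrom (+ h) p ℕ.≟ j)

count : (L h j : ℕ) → ℕ
count L h j = length (filter (dyckFrom? h j) (stepSequences L))

count-split : ∀ L h j → count (suc L) h j ≡
  count L (suc h) j ℕ.+ length (filter (dyckFrom? h j ∘ (down ∷_)) (stepSequences L))
count-split L h j = begin
  length (filter Q? (map (up ∷_) ps ++ map (down ∷_) ps))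
    ≡⟨ cong length (filter-++ Q? (map (up ∷_) ps) (map (down ∷_) ps)) ⟩
  length (filter Q? (map (up ∷_) ps) ++ filter Q? (map (down ∷_) ps))
    ≡⟨ length-++ (filter Q? (map (up ∷_) ps)) ⟩
  length (filter Q? (map (up ∷_) ps)) ℕ.+ length (filter Q? (map (down ∷_) ps))
    ≡⟨ cong₂ ℕ._+_ (length-filter-map Q? (up ∷_) ps) (length-filter-map Q? (down ∷_) ps) ⟩
  length (filter (Q? ∘ (up ∷_)) ps) ℕ.+ length (filter (Q? ∘ (down ∷_)) ps)
    ≡⟨ cong (ℕ._+ length (filter (Q? ∘ (down ∷_)) ps))
         (length-filter-≐ (Q? ∘ (up ∷_)) (dyckFrom? (suc h) j)
           ((λ { ((_ ∷ a , e) , r) → (a , e) , r }) , (λ { ((a , e) , r) → (ℤ.+≤+ z≤n ∷ a , e) , r })) ps) ⟩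
  count L (suc h) j ℕ.+ length (filter (Q? ∘ (down ∷_)) ps) ∎
  where
  open ≡-Reasoning
  Q? = dyckFrom? h j
  ps = stepSequences L

count-0 : ∀ L j → count (suc L) 0 j ≡ count L 1 j
count-0 L j = trans (count-split L 0 j) (trans
  (cong (count L 1 j ℕ.+_)
    (length-filter-none (dyckFrom? 0 j ∘ (down ∷_)) (λ { _ ((() ∷ _ , _) , _) }) (stepSequences L)))
  (ℕ.+-identityʳ _))

count-1-0 : ∀ L → count (suc L) 1 0 ≡ count L 2 0
count-1-0 L = trans (count-split L 1 0) (trans
  (cong (count L 2 0 ℕ.+_)
    (length-filter-none (dyckFrom? 1 0 ∘ (down ∷_)) (λ { _ (_ , ()) }) (stepSequences L)))
  (ℕ.+-identityʳ _))

count-1-suc : ∀ L j → count (suc L) 1 (suc j) ≡ count L 2 (suc j) ℕ.+ count L 0 j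
count-1-suc L j = trans (count-split L 1 (suc j)) (cong (count L 2 (suc j) ℕ.+_)
  (length-filter-≐ (dyckFrom? 1 (suc j) ∘ (down ∷_)) (dyckFrom? 0 j)
    ((λ { ((_ ∷ a , e) , r) → (a , e) , ℕ.suc-injective r }) , (λ { ((a , e) , r) → (ℤ.+≤+ z≤n ∷ a , e) , cong suc r }))
    (stepSequences L)))

count-suc-suc : ∀ L h j → count (suc L) (2 ℕ.+ h) j ≡ count L (3 ℕ.+ h) j ℕ.+ count L (suc h) j
count-suc-suc L h j = trans (count-split L (2 ℕ.+ h) j) (cong (count L (3 ℕ.+ h) j ℕ.+_)
  (length-filter-≐ (dyckFrom? (2 ℕ.+ h) j ∘ (down ∷_)) (dyckFrom? (suc h) j)
    ((λ { ((_ ∷ a , e) , r) → (a , e) , r }) , (λ { ((a , e) , r) → (ℤ.+≤+ z≤n ∷ a , e) , r }))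
    (stepSequences L)))

count-no-returns : ∀ L h → count L (suc h) 0 ≡ 0
count-no-returns zero    h       = refl
count-no-returns (suc L) zero    = trans (count-1-0 L) (count-no-returns L 1)
count-no-returns (suc L) (suc h) =
  trans (count-suc-suc L h 0) (cong₂ ℕ._+_ (count-no-returns L (2 ℕ.+ h)) (count-no-returns L h))

mutual
  -- A path with j returns has at least 2j steps, and one from height 1 + h with 1 + j returns at
  -- least 1 + h + 2j. This settles the case n = 0 of `count-up`, where no up step fits.
  count-short₀ : ∀ L j → L < j ℕ.+ j → count L 0 j ≡ 0
  count-short₀ zero    (suc j) _ = refl
  count-short₀ (suc L) (suc j) L<j+j = trans (count-0 L (suc j))
    (count-short₁ L 0 j (ℕ.s≤s⁻¹ (ℕ.s≤s⁻¹ (subst (2 ℕ.+ L ≤_) (cong suc (ℕ.+-suc j j)) L<j+j))))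

  count-short₁ : ∀ L h j → L ≤ h ℕ.+ (j ℕ.+ j) → count L (suc h) (suc j) ≡ 0
  count-short₁ zero    h       j _    = refl
  count-short₁ (suc L) zero    j L<   = trans (count-1-suc L j) (cong₂ ℕ._+_
    (count-short₁ L 1 j (ℕ.m≤n⇒m≤1+n (ℕ.<⇒≤ L<))) (count-short₀ L j L<))
  count-short₁ (suc L) (suc h) j L<   = trans (count-suc-suc L h (suc j)) (cong₂ ℕ._+_
    (count-short₁ L (2 ℕ.+ h) j (ℕ.m≤n⇒m≤1+n (ℕ.<⇒≤ L<)))
    (count-short₁ L h j (ℕ.s≤s⁻¹ L<)))

P-at-0 : ∀ k → P k 0 ≡ 1ℤ
P-at-0 zero    = const-0 1ℤ
P-at-0 (suc k) = trans (trans (at (P-rec k) 0) (⊕X⊗-0 _ _)) (P-at-0 k)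

P-at-suc : ∀ k n → P (suc k) (suc n) ≡ P (2 ℕ.+ k) n + P k (suc n)
P-at-suc k n = trans (at (P-rec k) (suc n)) (trans (⊕X⊗-suc _ _ n) (ℤ.+-comm (P k (suc n)) (P (2 ℕ.+ k) n)))

-- A path from height 0 with j returns is made of j excursions, each counted by c. From height
-- 1 + h with 1 + j returns there are 1 + h excursions before the first return, one above each
-- level left on the way down, and j after it. Half the total length of the excursions is n.
mutual
  count≡P₀ : ∀ L j n → L ≡ j ℕ.+ j ℕ.+ (n ℕ.+ n) → + count L 0 j ≡ P j n
  count≡P₀ zero    zero    zero    _  = sym (P-at-0 0)
  count≡P₀ (suc L) zero    (suc n) _  =
    trans (cong +_ (trans (count-0 L 0) (count-no-returns L 0))) (sym (const-suc 1ℤ n))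
  count≡P₀ (suc L) (suc j) n       eq = trans (cong +_ (count-0 L (suc j)))
    (count≡P₁ L 0 j n (trans (ℕ.suc-injective eq) (cong (ℕ._+ (n ℕ.+ n)) (ℕ.+-suc j j))))

  count≡P₁ : ∀ L h j n → L ≡ suc h ℕ.+ (j ℕ.+ j ℕ.+ (n ℕ.+ n)) → + count L (suc h) (suc j) ≡ P (suc (h ℕ.+ j)) n
  count≡P₁ (suc L) zero    j n eq = trans (cong +_ (count-1-suc L j))
    (count-up L 0 j n (ℕ.suc-injective eq) (count≡P₀ L j n (ℕ.suc-injective eq)))
  count≡P₁ (suc L) (suc h) j n eq = trans (cong +_ (count-suc-suc L h (suc j)))
    (count-up L (suc h) j n (ℕ.suc-injective eq) (count≡P₁ L h j n (ℕ.suc-injective eq)))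

  -- An up step raises the exponent of c by one and lowers n by one; a down step, counted by `m`,
  -- lowers the exponent by one. This is `P-rec` read coefficientwise.
  count-up : ∀ L h j n → L ≡ h ℕ.+ (j ℕ.+ j ℕ.+ (n ℕ.+ n)) → ∀ {m} → + m ≡ P (h ℕ.+ j) n →
             + (count L (2 ℕ.+ h) (suc j) ℕ.+ m) ≡ P (suc (h ℕ.+ j)) n
  count-up L h j zero eq {m} m≡ = trans
    (cong (λ z → + (z ℕ.+ m)) (count-short₁ L (suc h) j
      (ℕ.m≤n⇒m≤1+n (ℕ.≤-reflexive (trans eq (cong (h ℕ.+_) (ℕ.+-identityʳ (j ℕ.+ j))))))))
    (trans m≡ (trans (P-at-0 (h ℕ.+ j)) (sym (P-at-0 (suc (h ℕ.+ j))))))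
  count-up L h j (suc n) eq m≡ = trans
    (cong₂ _+_ (count≡P₁ L (suc h) j n (trans eq
      (solve 3 (λ h j n → h :+ (j :+ j :+ ((con 1 :+ n) :+ (con 1 :+ n))) := con 2 :+ h :+ (j :+ j :+ (n :+ n))) refl h j n))) m≡)
    (sym (P-at-suc (h ℕ.+ j) n))
    where open ℕ.+-*-Solver

A : Series
A = stack (P ∘ suc)

-- For j = k + 1 the semilength n + 2 - j equals j + (n - 2k). The outer steps of the j excursions
-- use up j, which leaves the coefficient of x^(n-2k) in c^j.
A030238≡A : ∀ n → + A030238 n ≡ A n
A030238≡A n = trans
  (cong (λ m → + (∑ℕ m λ j → dyckWithReturns (n ℕ.+ 2 ∸ j) j)) (cong ⌊_/2⌋ (ℕ.+-comm n 2)))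
  (sum-stack (λ k → dyckWithReturns (n ℕ.+ 2 ∸ suc k) (suc k)) (P ∘ suc) n λ k k*2≤n →
    count≡P₀ (2 ℕ.* (n ℕ.+ 2 ∸ suc k)) (suc k) (n ∸ k ℕ.* 2)
      (subst (λ m → 2 ℕ.* (m ℕ.+ 2 ∸ suc k) ≡ suc k ℕ.+ suc k ℕ.+ ((n ∸ k ℕ.* 2) ℕ.+ (n ∸ k ℕ.* 2)))
        (ℕ.m+[n∸m]≡n k*2≤n) (semilength k (n ∸ k ℕ.* 2))))
  where
  open ℕ.+-*-Solver
  semilength : ∀ k r → 2 ℕ.* (k ℕ.* 2 ℕ.+ r ℕ.+ 2 ∸ suc k) ≡ suc k ℕ.+ suc k ℕ.+ (r ℕ.+ r)
  semilength k r = trans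
    (cong (2 ℕ.*_) (trans
      (cong (_∸ suc k) (solve 2 (λ k r → k :* con 2 :+ r :+ con 2 := con 1 :+ k :+ r :+ (con 1 :+ k)) refl k r))
      (ℕ.m+n∸n≡m (suc k ℕ.+ r) (suc k))))
    (solve 2 (λ k r → con 2 :* (con 1 :+ k :+ r) := con 1 :+ k :+ (con 1 :+ k) :+ (r :+ r)) refl k r)

A-equation : A ≈ c ⊕ X ⊗ (X ⊗ (c ⊗ A))
A-equation = stack-geometric c (P ∘ suc) (P-suc ∘ suc)

-- Recurrences as equations between series

sum-convolution : ∀ f g n → sumℤ {suc n} (λ k → f (toℕ k) * g (n ∸ toℕ k)) ≡ convolution f g n
sum-convolution f g zero    = ℤ.+-identityʳ (f 0 * g 0)
sum-convolution f g (suc n) = cong (λ z → f 0 * g (suc n) + z) (sum-convolution (f ∘ suc) g n)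

-- The sign absorbs the alternation in the recurrence of `u`, leaving plain Catalan coefficients. It
-- is also the sign that relates D₊ to a E in `D₊-suc`.
U : Series
U n = (-1ℤ) ^ n * u (suc n)

c-tail : c ≈ const 1ℤ ⊕ X ⊗ (c ∘ suc)
c-tail = ≈-trans (head-tail c) (⊕-cong (pointwise λ n → cong (λ z → const z n) (sym (catalan≡c 0))) ≈-refl)

[-1]^n*[-1]^n≡1 : ∀ n → (-1ℤ) ^ n * (-1ℤ) ^ n ≡ 1ℤ
[-1]^n*[-1]^n≡1 zero    = refl
[-1]^n*[-1]^n≡1 (suc n) = trans
  (solve 1 (λ r → con -1ℤ :* r :* (con -1ℤ :* r) := r :* r) refl ((-1ℤ) ^ n)) ([-1]^n*[-1]^n≡1 n)
  where open ℤ.+-*-Solver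

[2+n∸k]∸1≡1+[n∸k] : ∀ {k n} → k ≤ n → (2 ℕ.+ n ∸ k) ∸ 1 ≡ suc (n ∸ k)
[2+n∸k]∸1≡1+[n∸k] {k} {n} k≤n = cong (_∸ 1) (ℕ.+-∸-assoc 2 k≤n)

U-rec : ∀ n → U (2 ℕ.+ n) ≡ - U (suc n) + convolution (c ∘ suc) U n
U-rec n = begin
  -1ℤ * (-1ℤ * s) * u (3 ℕ.+ n)
    ≡⟨ cong (-1ℤ * (-1ℤ * s) *_) (u-rec (3 ℕ.+ n) (s≤s (s≤s (s≤s z≤n)))) ⟩
  -1ℤ * (-1ℤ * s) * (u (2 ℕ.+ n) + sumℤ {suc n} (λ k → term (toℕ k)))
    ≡⟨ solve 3 (λ s a b → con -1ℤ :* (con -1ℤ :* s) :* (a :+ b) := :- (con -1ℤ :* s :* a) :+ s :* b) refl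
         s (u (2 ℕ.+ n)) (sumℤ {suc n} (λ k → term (toℕ k))) ⟩
  - U (suc n) + s * sumℤ {suc n} (λ k → term (toℕ k))
    ≡⟨ cong (λ z → - U (suc n) + s * z) (trans (sumℤ-cong {suc n} λ k → term≡ (toℕ k) (ℕ.s≤s⁻¹ (toℕ<n k))) (sum-convolution f (u ∘ suc) n)) ⟩
  - U (suc n) + s * convolution f (u ∘ suc) n
    ≡⟨ cong (λ z → - U (suc n) + z) (trans (conv-geometric -1ℤ f (u ∘ suc) n)
         (conv-cong n (λ {k} _ → unsign k) (λ _ → refl))) ⟩
  - U (suc n) + convolution (c ∘ suc) U n ∎
  where
  open ≡-Reasoning
  open ℤ.+-*-Solver
  s = (-1ℤ) ^ n
  f : Series
  f k = (-1ℤ) ^ k * c (suc k)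
  term : ℕ → ℤ
  term k = (-1ℤ) ^ (suc k ℕ.+ 1) * + catalan (suc k) * u (3 ℕ.+ n ∸ suc k ∸ 1)
  term≡ : ∀ k → k ≤ n → term k ≡ f k * u (suc (n ∸ k))
  term≡ k k≤n = cong₂ _*_
    (cong₂ _*_ (trans (cong (λ m → -1ℤ * (-1ℤ) ^ m) (ℕ.+-comm k 1))
        (solve 1 (λ r → con -1ℤ :* (con -1ℤ :* r) := r) refl ((-1ℤ) ^ k))) (catalan≡c (suc k)))
    (cong u ([2+n∸k]∸1≡1+[n∸k] k≤n))
  unsign : ∀ k → (-1ℤ) ^ k * f k ≡ c (suc k)
  unsign k = trans (sym (ℤ.*-assoc ((-1ℤ) ^ k) ((-1ℤ) ^ k) (c (suc k))))
    (trans (cong (_* c (suc k)) ([-1]^n*[-1]^n≡1 k)) (ℤ.*-identityˡ (c (suc k))))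

U-equation : U ≈ const 1ℤ ⊕ X ⊗ (⊝ U ⊕ X ⊗ ((c ∘ suc) ⊗ U))
U-equation = pointwise λ where
  0 → sym (trans (⊕X⊗-0 _ _) (const-0 1ℤ))
  -- The initial value u₂ = u₁ fits the recurrence with an empty sum.
  1 → sym (trans (const⊕X⊗-suc 1ℤ _ 0) (trans (⊕X⊗-0 (⊝ U) _) (⊝-at U 0)))
  (suc (suc n)) → trans (U-rec n) (sym (trans (const⊕X⊗-suc 1ℤ _ (suc n))
    (trans (⊕X⊗-suc (⊝ U) _ n) (cong₂ _+_ (⊝-at U (suc n)) (⊗-at _ U n)))))

W : Series
W n = + A137398 (suc n)

+-sum : ∀ {n} (t : Fin n → ℕ) → + sumℕ t ≡ sumℤ (λ k → + t k)
+-sum {zero}  t = refl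
+-sum {suc n} t = cong (λ z → + t Fin.zero + z) (+-sum (t ∘ Fin.suc))

-- The convolution has one summand more than the recurrence, with the factor W 0 = 0.
W-rec : ∀ n → W (3 ℕ.+ n) ≡ + 2 * W (2 ℕ.+ n) + + 2 * W (suc n) + convolution (c ∘ suc) W (suc n)
W-rec n = begin
  + A137398 (4 ℕ.+ n)
    ≡⟨ cong +_ (A137398-rec (4 ℕ.+ n) (s≤s (s≤s (s≤s (s≤s z≤n))))) ⟩
  + (2 ℕ.* A137398 (3 ℕ.+ n)) + + (2 ℕ.* A137398 (2 ℕ.+ n)) + + sumℕ {suc n} (λ k → term (toℕ k))
    ≡⟨ cong₂ _+_ (cong₂ _+_ (ℤ.pos-* 2 (A137398 (3 ℕ.+ n))) (ℤ.pos-* 2 (A137398 (2 ℕ.+ n)))) terms ⟩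
  + 2 * W (2 ℕ.+ n) + + 2 * W (suc n) + convolution (c ∘ suc) W (suc n) ∎
  where
  open ≡-Reasoning
  term : ℕ → ℕ
  term k = catalan (suc k) ℕ.* A137398 (4 ℕ.+ n ∸ suc k ∸ 1)
  term≡ : ∀ k → k ≤ n → + term k ≡ c (suc k) * W (suc (n ∸ k))
  term≡ k k≤n = trans (ℤ.pos-* (catalan (suc k)) _)
    (cong₂ _*_ (catalan≡c (suc k)) (cong (λ m → + A137398 (m ∸ 1)) (ℕ.+-∸-assoc 3 k≤n)))
  terms : + sumℕ {suc n} (λ k → term (toℕ k)) ≡ convolution (c ∘ suc) W (suc n)
  terms = begin
    + sumℕ {suc n} (λ k → term (toℕ k))                 ≡⟨ +-sum {suc n} (λ k → term (toℕ k)) ⟩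
    sumℤ {suc n} (λ k → + term (toℕ k))                 ≡⟨ sumℤ-cong {suc n} (λ k → term≡ (toℕ k) (ℕ.s≤s⁻¹ (toℕ<n k))) ⟩
    sumℤ {suc n} (λ k → c (suc (toℕ k)) * W (suc (n ∸ toℕ k))) ≡⟨ sum-convolution (c ∘ suc) (W ∘ suc) n ⟩
    convolution (c ∘ suc) (W ∘ suc) n                   ≡⟨ ℤ.+-identityˡ _ ⟨
    0ℤ + convolution (c ∘ suc) (W ∘ suc) n
      ≡⟨ cong (_+ convolution (c ∘ suc) (W ∘ suc) n) (ℤ.*-zeroʳ (c (2 ℕ.+ n))) ⟨
    c (2 ℕ.+ n) * W 0 + convolution (c ∘ suc) (W ∘ suc) n ≡⟨ conv-sucʳ (c ∘ suc) W n ⟨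
    convolution (c ∘ suc) W (suc n)                     ∎

W-rec′ : W ∘ suc ∘ suc ≈ const (+ 2) ⊗ (W ∘ suc) ⊕ const (+ 2) ⊗ W ⊕ (c ∘ suc) ⊗ W
W-rec′ = pointwise λ n → trans (rec n) (sym (trans (⊕-at _ _ n) (cong₂ _+_
  (trans (⊕-at _ _ n) (cong₂ _+_ (const-⊗-at (+ 2) _ n) (const-⊗-at (+ 2) W n))) (⊗-at _ W n))))
  where
  rec : ∀ n → W (2 ℕ.+ n) ≡ + 2 * W (suc n) + + 2 * W n + convolution (c ∘ suc) W n
  -- The initial value b₃ = 2 fits as well: W 1 = 1 contributes 2, and the terms with W 0 vanish.
  rec zero    = cong (λ z → + 2 + z) (sym (ℤ.*-zeroʳ (c 1)))
  rec (suc n) = W-rec n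

-- The six identities

module _ where
  open Solver

  -- From 1/c = 1 - x c and x c² = c - 1 follows 1/c² = 1 - x - x c, and 1/H = (1 - x² c²)/c² = 1/c²
  -- - x².
  H-inverse : H ⊗ (const 1ℤ ⊕ ⊝ (X ⊗ (c ⊕ (const 1ℤ ⊕ X ⊗ const 1ℤ)))) ≈ const 1ℤ
  H-inverse = linearCombination₃ H≈c²F F-equation c-equation
    (solve 4 (λ f h c x →
       let y = con 1ℤ :+ :- (x :* (c :+ (con 1ℤ :+ x :* con 1ℤ)))
           q = :- y
           q′ = con -1ℤ
           q″ = :- (f :* (con 1ℤ :+ c))
       in h :* y :+ q :* h :+ q′ :* f :+ q″ :* c :=
          con 1ℤ :+ q :* (c :* c :* f) :+ q′ :* (con 1ℤ :+ x :* (x :* (c :* c :* f))) :+ q″ :* (con 1ℤ :+ x :* (c :* c)))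
     ≈-refl F H c X)

  J≈ : (c ⊕ (const 1ℤ ⊕ X ⊗ const 1ℤ)) ⊗ H ≈ J
  J≈ = X⊗-cancel (linearCombination₂ H-inverse H-tail
    (solve 4 (λ h j c x →
       let v = c :+ (con 1ℤ :+ x :* con 1ℤ)
       in x :* (v :* h) :+ con 1ℤ :* (h :* (con 1ℤ :+ :- (x :* v))) :+ con -1ℤ :* h :=
          x :* j :+ con 1ℤ :* con 1ℤ :+ con -1ℤ :* (con 1ℤ :+ x :* j))
     ≈-refl H J c X))

  module _ {E : Series} where

    -- The ratio c - 2 comes from 1/F + x = 1 - x (c - 2). The equation of `U` has the same ratio
    -- because x (c ∘ suc) = c - 1.
    F⊗E≈U : E ≈ const 1ℤ ⊕ X ⊗ (const -1ℤ ⊗ (F ⊗ E)) → F ⊗ E ≈ U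
    F⊗E≈U E-eq = solution-unique (const 1ℤ) (c ⊕ const (- + 2))
      (linearCombination₃ E-eq F-equation c-equation
        (solve 4 (λ e f c x →
           let q = con -1ℤ
               q′ = :- e
               q″ = x :* f :* e
           in f :* e :+ q :* e :+ q′ :* f :+ q″ :* c :=
              con 1ℤ :+ x :* ((c :+ con (- + 2)) :* (f :* e)) :+ q :* (con 1ℤ :+ x :* (con -1ℤ :* (f :* e)))
                :+ q′ :* (con 1ℤ :+ x :* (x :* (c :* c :* f))) :+ q″ :* (con 1ℤ :+ x :* (c :* c)))
         ≈-refl E F c X))
      (linearCombination₂ U-equation c-tail
        (solve 4 (λ u c c′ x →
           u :+ con -1ℤ :* u :+ x :* u :* c :=
           con 1ℤ :+ x :* ((c :+ con (- + 2)) :* u) :+ con -1ℤ :* (con 1ℤ :+ x :* (:- u :+ x :* (c′ :* u)))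
             :+ x :* u :* (con 1ℤ :+ x :* c′))
         ≈-refl U c (c ∘ suc) X))

    -- Here 1/F - x = 1 - x c = 1/c. The equation solved by both sides has ratio F, and c satisfies
    -- it as c = F (1 + x c).
    F⊗E≈c : E ≈ const 1ℤ ⊕ X ⊗ (const 1ℤ ⊗ (F ⊗ E)) → F ⊗ E ≈ c
    F⊗E≈c E-eq = solution-unique F F
      (linearCombination E-eq
        (solve 3 (λ e f x → f :* e :+ :- f :* e :=
           f :+ x :* (f :* (f :* e)) :+ :- f :* (con 1ℤ :+ x :* (con 1ℤ :* (f :* e))))
         ≈-refl E F X))
      (linearCombination₂ F-equation c-equation
        (solve 3 (λ f c x →
           let q = c
               q′ = :- (f :* (con 1ℤ :+ x :* c))
           in c :+ q :* f :+ q′ :* c :=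
              f :+ x :* (f :* c) :+ q :* (con 1ℤ :+ x :* (x :* (c :* c :* f))) :+ q′ :* (con 1ℤ :+ x :* (c :* c)))
         ≈-refl F c X))

    -- As 1 + x G = F, the product is G/F = (1 - 1/F)/x = x c².
    G⊗E≈c-1 : E ≈ const 1ℤ ⊕ X ⊗ (const -1ℤ ⊗ (G ⊗ E)) → G ⊗ E ≈ c ⊕ const -1ℤ
    G⊗E≈c-1 E-eq = solution-unique G (⊝ G)
      (linearCombination E-eq
        (solve 3 (λ e g x → g :* e :+ :- g :* e :=
           g :+ x :* (:- g :* (g :* e)) :+ :- g :* (con 1ℤ :+ x :* (con -1ℤ :* (g :* e))))
         ≈-refl E G X))
      (linearCombination₂ F-tail c-equation (linearCombination₂ G-tail H≈c²F
        (solve 5 (λ f g h c x →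
           let q = c :+ con -1ℤ
           in c :+ con -1ℤ :+ q :* f :+ :- f :* c :+ con 1ℤ :* g :+ x :* h :=
              g :+ x :* (:- g :* (c :+ con -1ℤ)) :+ q :* (con 1ℤ :+ x :* g) :+ :- f :* (con 1ℤ :+ x :* (c :* c))
                :+ con 1ℤ :* (x :* h) :+ x :* (c :* c :* f))
         ≈-refl F G H c X)))

    -- Since G = x H, the product is x/(1/H - x²) = x/(1 - x (1 + 2x + c)), the source of the ratio.
    G⊗E≈W : E ≈ const 1ℤ ⊕ X ⊗ (const 1ℤ ⊗ (G ⊗ E)) → G ⊗ E ≈ W
    G⊗E≈W E-eq = solution-unique X (const 1ℤ ⊕ const (+ 2) ⊗ X ⊕ c)
      (linearCombination₃ E-eq G-tail H-inverse
        (solve 5 (λ e g h c x →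
           let y = con 1ℤ :+ :- (x :* (c :+ (con 1ℤ :+ x :* con 1ℤ)))
               q = :- x
               q′ = :- (e :* y)
               q″ = :- (e :* x)
           in g :* e :+ q :* e :+ q′ :* g :+ q″ :* (h :* y) :=
              x :+ x :* ((con 1ℤ :+ con (+ 2) :* x :+ c) :* (g :* e)) :+ q :* (con 1ℤ :+ x :* (con 1ℤ :* (g :* e)))
                :+ q′ :* (x :* h) :+ q″ :* con 1ℤ)
         ≈-refl E G H c X))
      (linearCombination₂ (head-tail W) (head-tail (W ∘ suc)) (linearCombination₂ W-rec′ c-tail
        (solve 6 (λ w w₁ w₂ c c′ x →
           let q = con (+ 2) :* x :+ con -1ℤ
               q′ = :- x
               q″ = :- (x :* x)
               q‴ = x :* w
           in w :+ q :* w :+ q′ :* w₁ :+ q″ :* w₂ :+ q‴ :* c :=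
              x :+ x :* ((con 1ℤ :+ con (+ 2) :* x :+ c) :* w) :+ q :* (con 0ℤ :+ x :* w₁) :+ q′ :* (con 1ℤ :+ x :* w₂)
                :+ q″ :* (con (+ 2) :* w₁ :+ con (+ 2) :* w :+ c′ :* w) :+ q‴ :* (con 1ℤ :+ x :* c′))
         ≈-refl W (W ∘ suc) (W ∘ suc ∘ suc) c (c ∘ suc) X)))

    -- Both are 1/(1 - x c - x²): the left side as 1/(1/H + x), the right side as 1/(1/c - x²).
    H⊗E≈A : E ≈ const 1ℤ ⊕ X ⊗ (const -1ℤ ⊗ (H ⊗ E)) → H ⊗ E ≈ A
    H⊗E≈A E-eq = solution-unique c (X ⊗ c)
      (linearCombination₂ E-eq F-equation (linearCombination₂ H≈c²F c-equation
        (solve 5 (λ e f h c x →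
           let q = :- c
               q′ = :- (e :* c)
               q″ = :- (e :* (con 1ℤ :+ :- (x :* x :* c) :+ :- (x :* c)))
               q‴ = :- (e :* c :* f)
           in h :* e :+ q :* e :+ q′ :* f :+ q″ :* h :+ q‴ :* c :=
              c :+ x :* (x :* c :* (h :* e)) :+ q :* (con 1ℤ :+ x :* (con -1ℤ :* (h :* e)))
                :+ q′ :* (con 1ℤ :+ x :* (x :* (c :* c :* f))) :+ q″ :* (c :* c :* f) :+ q‴ :* (con 1ℤ :+ x :* (c :* c)))
         ≈-refl E F H c X)))
      (linearCombination A-equation
        (solve 3 (λ a c x → a :+ con -1ℤ :* a := c :+ x :* (x :* c :* a) :+ con -1ℤ :* (c :+ x :* (x :* (c :* a))))
         ≈-refl A c X))

    -- As 1 + x J = H, the product is J/H = (1 - 1/H)/x, which `H-inverse` evaluates.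
    J⊗E≈c+1+X : E ≈ const 1ℤ ⊕ X ⊗ (const -1ℤ ⊗ (J ⊗ E)) → J ⊗ E ≈ c ⊕ (const 1ℤ ⊕ X ⊗ const 1ℤ)
    J⊗E≈c+1+X E-eq = solution-unique J (⊝ J)
      (linearCombination E-eq
        (solve 3 (λ e j x → j :* e :+ :- j :* e :=
           j :+ x :* (:- j :* (j :* e)) :+ :- j :* (con 1ℤ :+ x :* (con -1ℤ :* (j :* e))))
         ≈-refl E J X))
      (linearCombination₂ H-tail J≈
        (solve 4 (λ h j c x →
           let v = c :+ (con 1ℤ :+ x :* con 1ℤ)
           in v :+ v :* h :+ con -1ℤ :* (v :* h) :=
              j :+ x :* (:- j :* v) :+ v :* (con 1ℤ :+ x :* j) :+ con -1ℤ :* j)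
         ≈-refl H J c X))

module _ (a : Series) where
  open ℤ.+-*-Solver
  open ≡-Reasoning

  D₊-suc : ∀ n → D 1ℤ a (suc n) ≡ (-1ℤ) ^ n * (a ⊗ signed 1ℤ a refl) n
  D₊-suc n = begin
    d                     ≡⟨ ℤ.*-identityˡ d ⟨
    1ℤ * d                ≡⟨ cong (_* d) ([-1]^n*[-1]^n≡1 n) ⟨
    s * s * d             ≡⟨ solve 2 (λ s d → s :* s :* d := con -1ℤ :* s :* (con -1ℤ :* s :* d)) refl s d ⟩
    -1ℤ * s * (-1ℤ * s * d) ≡⟨ cong (-1ℤ * s *_) (signed-suc 1ℤ a refl n) ⟩
    -1ℤ * s * (-1ℤ * e)   ≡⟨ solve 2 (λ s e → con -1ℤ :* s :* (con -1ℤ :* e) := s :* e) refl s e ⟩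
    s * e                 ∎
    where
    s = (-1ℤ) ^ n
    d = D 1ℤ a (suc n)
    e = (a ⊗ signed 1ℤ a refl) n

  D₋-suc : ∀ n → D -1ℤ a (suc n) ≡ (a ⊗ signed -1ℤ a refl) n
  D₋-suc n = begin
    d                    ≡⟨ ℤ.*-identityˡ d ⟨
    1ℤ * d               ≡⟨ cong (_* d) (ℤ.^-zeroˡ (suc n)) ⟨
    1ℤ ^ suc n * d       ≡⟨ signed-suc -1ℤ a refl n ⟩
    1ℤ * e               ≡⟨ ℤ.*-identityˡ e ⟩
    e                    ∎
    where
    d = D -1ℤ a (suc n)
    e = (a ⊗ signed -1ℤ a refl) n

theorem5 : (∀ (n : ℕ) → 1 ≤ n → D₊ (fineFrom 1 n) ≡ u n) ×
    (∀ (n : ℕ) → 1 ≤ n → D₋ (fineFrom 1 n) ≡ + catalan (n ∸ 1)) ×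
    (∀ (n : ℕ) → 2 ≤ n → D₊ (fineFrom 2 n) ≡ (-1ℤ ^ (n ∸ 1)) * + catalan (n ∸ 1)) ×
    (∀ (n : ℕ) → 1 ≤ n → D₋ (fineFrom 2 n) ≡ + A137398 n) ×
    (∀ (n : ℕ) → 1 ≤ n → D₊ (fineFrom 3 n) ≡ (-1ℤ ^ (n ∸ 1)) * + A030238 (n ∸ 1)) ×
    (∀ (n : ℕ) → 3 ≤ n → D₊ (fineFrom 4 n) ≡ (-1ℤ ^ (n ∸ 1)) * + catalan (n ∸ 1))
theorem5 =
    (λ { (suc n) _ → trans (D₊-suc F n) (trans (cong ((-1ℤ) ^ n *_) (at (F⊗E≈U (signed-equation 1ℤ F refl)) n))
           (trans (sym (ℤ.*-assoc ((-1ℤ) ^ n) ((-1ℤ) ^ n) (u (suc n))))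
             (trans (cong (_* u (suc n)) ([-1]^n*[-1]^n≡1 n)) (ℤ.*-identityˡ (u (suc n)))))) })
  , (λ { (suc n) _ → trans (D₋-suc F n) (trans (at (F⊗E≈c (signed-equation -1ℤ F refl)) n) (sym (catalan≡c n))) })
  -- The series c - 1 agrees with c except in its constant term, hence n ≥ 2.
  , (λ { (suc (suc n)) _ → trans (D₊-suc G (suc n)) (cong ((-1ℤ) ^ suc n *_)
           (trans (at (G⊗E≈c-1 (signed-equation 1ℤ G refl)) (suc n))
             (trans (⊕-at c (const -1ℤ) (suc n)) (trans (cong (λ z → c (suc n) + z) (const-suc -1ℤ n))
               (trans (ℤ.+-identityʳ (c (suc n))) (sym (catalan≡c (suc n)))))))) ; (suc zero) (s≤s ()) })
  , (λ { (suc n) _ → trans (D₋-suc G n) (at (G⊗E≈W (signed-equation -1ℤ G refl)) n) })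
  , (λ { (suc n) _ → trans (D₊-suc H n) (cong ((-1ℤ) ^ n *_)
           (trans (at (H⊗E≈A (signed-equation 1ℤ H refl)) n) (sym (A030238≡A n)))) })
  -- The added 1 + x changes the coefficients of x⁰ and x¹ only, hence n ≥ 3.
  , (λ { (suc (suc (suc n))) _ → trans (D₊-suc J (2 ℕ.+ n)) (cong ((-1ℤ) ^ (2 ℕ.+ n) *_)
           (trans (at (J⊗E≈c+1+X (signed-equation 1ℤ J refl)) (2 ℕ.+ n))
             (trans (⊕-at c _ (2 ℕ.+ n)) (trans (cong (λ z → c (2 ℕ.+ n) + z)
                 (trans (const⊕X⊗-suc 1ℤ (const 1ℤ) (suc n)) (const-suc 1ℤ n)))
               (trans (ℤ.+-identityʳ (c (2 ℕ.+ n))) (sym (catalan≡c (2 ℕ.+ n))))))))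
       ; (suc zero) (s≤s ()) ; (suc (suc zero)) (s≤s (s≤s ())) })
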